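{- $|\mathsf{PTAB}(\mathsf{S4BP}^{2,\omega}_{2,2})|=\aleph_0$.
   Context: Tense formulas use $\Box$ and a past possibility operator written here $\mathsf{P}$; $\mathsf{S4}_t=\mathsf{K}_t\oplus\{\Box p\to p,\Box p\to\Box\Box p\}$. $\mathsf{S4BP}^{2,\omega}_{2,2}$ is $\mathsf{S4}_t$ extended by axioms bounding depth by 2, forth-width by 2 and back-width by 2 (with $\mathbf{bd}_1=\Diamond\Box p_0\to p_0$, $\mathbf{bd}_2=\Diamond(\Box p_1\wedge\neg\mathbf{bd}_1)\to p_1$, $\mathbf{bw}^+_2=\bigwedge_{i\leq2}\Diamond p_i\to\bigvee_{i\neq j\leq2}\Diamond(p_i\wedge(p_j\vee\Diamond p_j))$, and $\mathbf{bw}^-_2$ the same with $\mathsf{P}$ in place of $\Diamond$); no bound on z-degree. $\mathsf{PTAB}(L)$ is the set of pretabular logics (non-tabular, every consistent proper extension tabular) extending $L$. -}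

module Defs where

open import Data.Nat using (ℕ)
open import Data.Fin using (Fin)
open import Data.Bool using (Bool; true)
open import Data.Empty using (⊥)
open import Data.Product using (Σ; _×_; ∃)
open import Data.Sum using (_⊎_)
open import Relation.Nullary using (¬_)
open import Relation.Binary.PropositionalEquality using (_≡_)

infixr 5 _⇒_

data Fm : Set where
  var : ℕ → Fm
  ⊥' : Fm
  _⇒_ : Fm → Fm → Fm
  □ : Fm → Fm
  ■ : Fm → Fm

¬' : Fm → Fm
¬' a = a ⇒ ⊥'

_∨'_ : Fm → Fm → Fm
a ∨' b = ¬' a ⇒ b

_∧'_ : Fm → Fm → Fm
a ∧' b = ¬' (a ⇒ ¬' b)

◇ : Fm → Fm
◇ a = ¬' (□ (¬' a))

𝖯 : Fm → Fm
𝖯 a = ¬' (■ (¬' a))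

subst' : (ℕ → Fm) → Fm → Fm
subst' σ (var i) = σ i
subst' σ ⊥' = ⊥'
subst' σ (a ⇒ b) = subst' σ a ⇒ subst' σ b
subst' σ (□ a) = □ (subst' σ a)
subst' σ (■ a) = ■ (subst' σ a)

p q r : Fm
p = var 0
q = var 1
r = var 2

Logic : Set₁
Logic = Fm → Set

_⊆L_ : Logic → Logic → Set
L ⊆L L' = ∀ φ → L φ → L' φ

_≐_ : Logic → Logic → Set
L ≐ L' = (L ⊆L L') × (L' ⊆L L)

record IsNTL (L : Logic) : Set where
  field
    ax1 : L (p ⇒ q ⇒ p)
    ax2 : L ((p ⇒ q ⇒ r) ⇒ (p ⇒ q) ⇒ p ⇒ r)
    ax3 : L (¬' (¬' p) ⇒ p)
    K□ : L (□ (p ⇒ q) ⇒ □ p ⇒ □ q)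
    K■ : L (■ (p ⇒ q) ⇒ ■ p ⇒ ■ q)
    conv□ : L (p ⇒ □ (𝖯 p))
    conv■ : L (p ⇒ ■ (◇ p))
    mp : ∀ {a b} → L (a ⇒ b) → L a → L b
    sub : ∀ σ {a} → L a → L (subst' σ a)
    nec□ : ∀ {a} → L a → L (□ a)
    nec■ : ∀ {a} → L a → L (■ a)

p0 p1 p2 : Fm
p0 = var 0
p1 = var 1
p2 = var 2

bd1 : Fm
bd1 = ◇ (□ p0) ⇒ p0

bd2 : Fm
bd2 = ◇ (□ p1 ∧' ¬' bd1) ⇒ p1

bw2 : (Fm → Fm) → Fm
bw2 M = (M p0 ∧' (M p1 ∧' M p2)) ⇒
        (c p0 p1 ∨' (c p0 p2 ∨' (c p1 p0 ∨' (c p1 p2 ∨' (c p2 p0 ∨' c p2 p1)))))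
  where
  c : Fm → Fm → Fm
  c a b = M (a ∧' (b ∨' M b))

bw2⁺ bw2⁻ : Fm
bw2⁺ = bw2 ◇
bw2⁻ = bw2 𝖯

ExtS4BP : Logic → Set
ExtS4BP L = IsNTL L × L (□ p ⇒ p) × L (□ p ⇒ □ (□ p))
          × L bd2 × L bw2⁺ × L bw2⁻

record FinFrame : Set₁ where
  field
    size : ℕ
    R : Fin size → Fin size → Set

module _ (F : FinFrame) where
  open FinFrame F
  Sat : (ℕ → Fin size → Bool) → Fin size → Fm → Set
  Sat V w (var i) = V i w ≡ true
  Sat V w ⊥' = ⊥
  Sat V w (a ⇒ b) = Sat V w a → Sat V w b
  Sat V w (□ a) = ∀ v → R w v → Sat V v a
  Sat V w (■ a) = ∀ v → R v w → Sat V v a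

  LogF : Logic
  LogF φ = ∀ V w → Sat V w φ

Tabular : Logic → Set₁
Tabular L = Σ FinFrame λ F → L ≐ LogF F

Pretabular : Logic → Set₁
Pretabular L = IsNTL L × ¬ Tabular L ×
  (∀ L' → IsNTL L' → L ⊆L L' → (∃ λ φ → L' φ × ¬ L φ) → ¬ L' ⊥' → Tabular L')

ExcludedMiddle : Set₁
ExcludedMiddle = (A : Set) → A ⊎ ¬ A

CountablyInfinitePTAB : Set₁
CountablyInfinitePTAB =
  Σ (ℕ → Logic) λ f →
    (∀ n → ExtS4BP (f n) × Pretabular (f n)) ×
    (∀ m n → f m ≐ f n → m ≡ n) ×
    (∀ L → ExtS4BP L → Pretabular L → ∃ λ n → L ≐ f n)

{-# OPTIONS --safe #-}
-- A frame for the logic is a disjoint union of fences and crowns of clusters.  The least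
-- informative ways to be infinite are an infinite fence of single points and a finite
-- connected skeleton one of whose clusters is infinite, and the logics of these countably
-- many frames are non-tabular.  Conversely, let L lie below none of them and consider its
-- canonical model.  A formula of L refuted on the infinite fence bounds the radius of the
-- components, since a long geodesic could be folded onto an initial part of the fence; a
-- formula of L refuted on a skeleton with an infinite cluster bounds the size of the
-- corresponding clusters.  So all components are finite and of bounded size, and L is the
-- logic of one finite frame.  Hence the pretabular logics are exactly the maximal logics of
-- the family.  There are infinitely many: over the fence of k + 1 points with an infinite
-- cluster at one end only finitely many members of the family lie, so there is a maximal one
-- among them, and the diameter k can be recovered from it.
module Submission where

open import Defs
open import Data.Nat using (ℕ; zero; suc; _+_; _*_; _^_; _⊔_; ∣_-_∣; _≤_; _<_; z≤n; s≤s; _≤′_; ≤′-refl; ≤′-step)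
open import Data.Nat.Properties using (≤⇒≤′; m≤m⊔n; m≤n⊔m; ≤-refl; +-suc; +-identityʳ; ≤-trans; m⊔n≤o⇒m≤o; m⊔n≤o⇒n≤o; suc-injective; m≤n+m; m<n⇒m<1+n; n<1+n; <⇒≤; <-irrefl; ≤-reflexive; +-mono-≤; ≮⇒≥; <-trans; <-≤-trans; <-cmp; ≤-<-trans; m≤m+n; +-cancelʳ-≡; +-monoʳ-≤; ∣m-m+n∣≡n; ∣-∣-identityʳ; m+[n∸m]≡n; ≤-total; n≤1+n; *-comm; *-monoˡ-≤; ≤-pred; ≰⇒>; m≤n⇒m<n∨m≡n; ≤-antisym; m∸n≤m; m∸n+n≡m; +-monoˡ-≤)
open import Data.Bool using (Bool; true; false; not; if_then_else_)
open import Data.Maybe using (Maybe; just; nothing; fromMaybe)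
open import Data.Fin using (Fin; zero; suc; toℕ; fromℕ<; splitAt; _↑ˡ_; _↑ʳ_; inject≤; funToFin; finToFun; fromℕ)
open import Data.Vec as Vec using (Vec; []; _∷_)
open import Data.List using (List; []; _∷_; _++_; map; concatMap; allFin; upTo; cartesianProductWith; length; lookup; tabulate)
open import Data.List.Membership.Propositional using (_∈_; lose)
open import Data.List.Membership.Propositional.Properties using (∈-++⁺ˡ; ∈-++⁺ʳ; ∈-map⁺; ∈-cartesianProductWith⁺; ∈-allFin; ∈-upTo⁺; ∈-concatMap⁺)
open import Data.List.Relation.Unary.Any as Any using (here; there; Any; index)
open import Data.Product using (Σ; _×_; _,_; proj₁; proj₂; ∃; uncurry)
open import Relation.Binary.PropositionalEquality using (_≡_; refl; sym; trans; cong; subst; _≢_)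
open import Data.Empty using (⊥; ⊥-elim)
open import Data.Sum as Sum using (_⊎_; inj₁; inj₂; [_,_]′; swap)
open import Function using (flip)
open import Relation.Nullary using (¬_; Dec; yes; no; does)
open import Data.Bool.Properties using (not-injective; not-involutive)
open import Data.Unit using (⊤; tt)
open import Data.Fin.Properties using (toℕ<n; toℕ-fromℕ<; toℕ-injective; pigeonhole; _≟_; splitAt-↑ˡ; splitAt-↑ʳ; splitAt⁻¹-↑ˡ; splitAt⁻¹-↑ʳ; <⇒≢; inject≤-injective; finToFun-funToFin; toℕ-fromℕ)
open import Data.Vec.Properties using (lookup∘tabulate)
open import Data.List.Properties using (length-++; length-tabulate)
open import Data.List.Relation.Unary.Any.Properties using (lookup-index; concatMap⁺; ++⁺ˡ; ++⁺ʳ; tabulate⁺)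
open import Relation.Binary using (tri<; tri≈; tri>)

-- Enumerations

-- Membership in `L` guarantees truth in the canonical model; validity on its frame is not known. So
-- a valuation refuting some `a` of `L` on a member of the family is pulled back along a map
-- definable by formulas: it becomes a substitution `σ`, and `subst' σ a`, again in `L`, is true
-- everywhere in the model. Definability comes from separating formulas, which tell finitely many
-- clusters or theories apart; values elsewhere are arbitrary. The refuted formula has finite modal
-- depth, so the fold must be a bisimulation only well inside the path. It has finitely many atoms,
-- so a cluster with enough theories to realise every pattern of atoms imitates an infinite one.
--
-- The bound on clusters has to be uniform over all components. The radius comes first: it bounds
-- the number of clusters in a component, so only finitely many pointed skeletons occur.
--
-- Pretabular logics are listed through codes, and several codes may share a logic, so each logic is
-- represented by its least index. Excluded middle turns predicates into Boolean valuations and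
-- codes.

diagonalStep : ℕ × ℕ → ℕ × ℕ
diagonalStep (zero , b) = suc b , zero
diagonalStep (suc a , b) = a , suc b

diagonal : ℕ → ℕ × ℕ
diagonal zero = zero , zero
diagonal (suc n) = diagonalStep (diagonal n)

diagonal-surjective : ∀ a b → ∃ λ n → diagonal n ≡ (a , b)
diagonal-surjective a b = go (a + b) b a refl
  where
  -- The walk is traced backwards, lexicographically in the antidiagonal `s` and in `b`: an
  -- antidiagonal starts where the previous one ends.
  go : ∀ s b a → a + b ≡ s → ∃ λ n → diagonal n ≡ (a , b)
  go zero zero zero e = zero , refl
  go (suc s) zero (suc a) e with go s a zero (trans (sym (+-identityʳ a)) (cong (λ { (suc x) → x ; zero → zero }) e))
  ... | n , h = suc n , cong diagonalStep h
  go s (suc b) a e with go s b (suc a) (trans (sym (+-suc a b)) e)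
  ... | n , h = suc n , cong diagonalStep h

nth : ∀ {A : Set} → List A → ℕ → Maybe A
nth [] i = nothing
nth (x ∷ l) zero = just x
nth (x ∷ l) (suc i) = nth l i

∈⇒nth : ∀ {A : Set} {a : A} {l} → a ∈ l → ∃ λ i → nth l i ≡ just a
∈⇒nth (here refl) = zero , refl
∈⇒nth (there m) with ∈⇒nth m
... | i , e = suc i , e

module FromLevels {A : Set} (level : ℕ → List A) (exhaustive : ∀ a → ∃ λ n → a ∈ level n) where
  enum : ℕ → Maybe A
  enum n = uncurry (λ k i → nth (level k) i) (diagonal n)

  enum-surjective : ∀ a → ∃ λ n → enum n ≡ just a
  enum-surjective a with exhaustive a
  ... | k , m with ∈⇒nth m
  ... | i , e with diagonal-surjective k i
  ... | n , h = n , trans (cong (uncurry (λ k i → nth (level k) i)) h) e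

-- The levels are cumulative, so that subformulas found at different levels meet at the larger one.
formulas : ℕ → List Fm
formulas zero = []
formulas (suc n) =
  var n ∷ ⊥' ∷ cartesianProductWith _⇒_ (formulas n) (formulas n)
  ++ map □ (formulas n) ++ map ■ (formulas n) ++ formulas n

formulas-suc : ∀ {n a} → a ∈ formulas n → a ∈ formulas (suc n)
formulas-suc {n} m = there (there (∈-++⁺ʳ (cartesianProductWith _⇒_ (formulas n) (formulas n))
  (∈-++⁺ʳ (map □ (formulas n)) (∈-++⁺ʳ (map ■ (formulas n)) m))))

formulas-mono : ∀ {m n a} → m ≤′ n → a ∈ formulas m → a ∈ formulas n
formulas-mono ≤′-refl h = h
formulas-mono (≤′-step l) h = formulas-suc (formulas-mono l h)

formulas-exhaustive : ∀ a → ∃ λ n → a ∈ formulas n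
formulas-exhaustive (var i) = suc i , here refl
formulas-exhaustive ⊥' = 1 , there (here refl)
formulas-exhaustive (a ⇒ b) with formulas-exhaustive a | formulas-exhaustive b
... | m , h | n , k = suc (m ⊔ n) , there (there (∈-++⁺ˡ (∈-cartesianProductWith⁺ _⇒_
  (formulas-mono (≤⇒≤′ (m≤m⊔n m n)) h) (formulas-mono (≤⇒≤′ (m≤n⊔m m n)) k))))
formulas-exhaustive (□ a) with formulas-exhaustive a
... | n , h = suc n , there (there (∈-++⁺ʳ (cartesianProductWith _⇒_ (formulas n) (formulas n))
  (∈-++⁺ˡ (∈-map⁺ □ h))))
formulas-exhaustive (■ a) with formulas-exhaustive a
... | n , h = suc n , there (there (∈-++⁺ʳ (cartesianProductWith _⇒_ (formulas n) (formulas n))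
  (∈-++⁺ʳ (map □ (formulas n)) (∈-++⁺ˡ (∈-map⁺ ■ h)))))

enumFm : ℕ → Fm
enumFm n = fromMaybe ⊥' (FromLevels.enum formulas formulas-exhaustive n)

enumFm-surjective : ∀ a → ∃ λ n → enumFm n ≡ a
enumFm-surjective a with FromLevels.enum-surjective formulas formulas-exhaustive a
... | n , e = n , cong (fromMaybe ⊥') e

-- Codes of finite frames

Matrix : ℕ → Set
Matrix n = Vec (Vec Bool n) n

entry : ∀ {n} → Matrix n → Fin n → Fin n → Bool
entry m i j = Vec.lookup (Vec.lookup m i) j

record PointedCode : Set where
  constructor pointed
  field
    {size} : ℕ
    point : Fin size
    matrix : Matrix size

vectors : ∀ {A : Set} → List A → ∀ n → List (Vec A n)
vectors l zero = [] ∷ []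
vectors l (suc n) = cartesianProductWith _∷_ l (vectors l n)

vectors-complete : ∀ {A : Set} {l : List A} → (∀ a → a ∈ l) → ∀ {n} (v : Vec A n) → v ∈ vectors l n
vectors-complete c [] = here refl
vectors-complete c (x ∷ v) = ∈-cartesianProductWith⁺ _∷_ (c x) (vectors-complete c v)

matrices : ∀ n → List (Matrix n)
matrices n = vectors (vectors (true ∷ false ∷ []) n) n

matrices-complete : ∀ {n} (m : Matrix n) → m ∈ matrices n
matrices-complete = vectors-complete (vectors-complete λ { true → here refl ; false → there (here refl) })

Code : Set
Code = Σ ℕ Matrix

codesUpTo : ℕ → List Code
codesUpTo k = concatMap (λ n → map (n ,_) (matrices n)) (upTo k)

codesUpTo-complete : ∀ {k n} (m : Matrix n) → n < k → (n , m) ∈ codesUpTo k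
codesUpTo-complete {k} {n} m l = ∈-concatMap⁺ (λ n → map (n ,_) (matrices n))
  (lose (∈-upTo⁺ l) (∈-map⁺ (n ,_) (matrices-complete m)))

pointedCodesUpTo : ℕ → List PointedCode
pointedCodesUpTo k = concatMap (λ { (n , m) → map (λ u → pointed u m) (allFin n) }) (codesUpTo k)

pointedCodesUpTo-complete : ∀ {k} (c : PointedCode) → PointedCode.size c < k → c ∈ pointedCodesUpTo k
pointedCodesUpTo-complete {k} (pointed {n} u m) l =
  ∈-concatMap⁺ (λ { (n , m) → map (λ u → pointed u m) (allFin n) })
    (lose (codesUpTo-complete m l) (∈-map⁺ (λ u → pointed u m) (∈-allFin u)))

pointedCodes-exhaustive : ∀ c → ∃ λ n → c ∈ pointedCodesUpTo n
pointedCodes-exhaustive c = suc (PointedCode.size c) , pointedCodesUpTo-complete c ≤-refl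

enumCode : ℕ → Maybe PointedCode
enumCode = FromLevels.enum pointedCodesUpTo pointedCodes-exhaustive

enumCode-surjective : ∀ c → ∃ λ n → enumCode n ≡ c
-- Level 0 is empty, so the walk begins with a miss; a miss doubles as the index of the zigzag.
enumCode-surjective nothing = zero , refl
enumCode-surjective (just c) = FromLevels.enum-surjective pointedCodesUpTo pointedCodes-exhaustive c

-- Kripke semantics

infix 1 _⟺_
_⟺_ : Set → Set → Set
A ⟺ B = (A → B) × (B → A)

record Frame : Set₁ where
  constructor frame
  field
    {World} : Set
    Rel : World → World → Set
open Frame

Valuation : Frame → Set
Valuation F = ℕ → World F → Bool

Holds : (F : Frame) → Valuation F → World F → Fm → Set
Holds F V w (var i) = V i w ≡ true
Holds F V w ⊥' = ⊥
Holds F V w (a ⇒ b) = Holds F V w a → Holds F V w b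
Holds F V w (□ a) = ∀ v → Rel F w v → Holds F V v a
Holds F V w (■ a) = ∀ v → Rel F v w → Holds F V v a

Log : Frame → Logic
Log F φ = ∀ V w → Holds F V w φ

module _ {W : Set} where
  Depth≤2 : (W → W → Set) → Set
  Depth≤2 R = ∀ {x y z} → R x y → R y z → R y x ⊎ R z y

  Width≤2 : (W → W → Set) → Set
  Width≤2 R = ∀ {x} (y : Fin 3 → W) → (∀ i → R x (y i)) → ∃ λ i → ∃ λ j → i ≢ j × R (y i) (y j)

record IsBP {W : Set} (R : W → W → Set) : Set where
  field
    R-refl : ∀ {x} → R x x
    R-trans : ∀ {x y z} → R x y → R y z → R x z
    depth : Depth≤2 R
    width⁺ : Width≤2 R
    width⁻ : Width≤2 (flip R)

pullback-isBP : ∀ {W U : Set} {R : U → U → Set} {S : W → W → Set} (f : W → U) →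
  (∀ x y → S x y ⟺ R (f x) (f y)) → IsBP R → IsBP S
pullback-isBP f e bp = record
  { R-refl = proj₂ (e _ _) R-refl
  ; R-trans = λ r s → proj₂ (e _ _) (R-trans (proj₁ (e _ _) r) (proj₁ (e _ _) s))
  ; depth = λ r s → Sum.map (proj₂ (e _ _)) (proj₂ (e _ _)) (depth (proj₁ (e _ _) r) (proj₁ (e _ _) s))
  ; width⁺ = λ y h → let i , j , n , r = width⁺ (λ i → f (y i)) (λ i → proj₁ (e _ _) (h i))
                     in i , j , n , proj₂ (e _ _) r
  ; width⁻ = λ y h → let i , j , n , r = width⁻ (λ i → f (y i)) (λ i → proj₁ (e _ _) (h i))
                     in i , j , n , proj₂ (e _ _) r }
  where open IsBP bp

Adj : ∀ {W : Set} → (W → W → Set) → W → W → Set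
Adj R x y = R x y ⊎ R y x

modalDepth : Fm → ℕ
modalDepth (var i) = 0
modalDepth ⊥' = 0
modalDepth (a ⇒ b) = modalDepth a ⊔ modalDepth b
modalDepth (□ a) = suc (modalDepth a)
modalDepth (■ a) = suc (modalDepth a)

varBound : Fm → ℕ
varBound (var i) = suc i
varBound ⊥' = 0
varBound (a ⇒ b) = varBound a ⊔ varBound b
varBound (□ a) = varBound a
varBound (■ a) = varBound a

-- A bisimulation up to modal depth n between (F , V) with the atom i read as the
-- formula σ i, and (G , U), for the atoms below k.
record Bisim (F G : Frame) (V : Valuation F) (U : Valuation G) (σ : ℕ → Fm) (k : ℕ)
             (Z : ℕ → World F → World G → Set) : Set where
  field
    atom : ∀ {n w x} → Z n w x → ∀ i → i < k → Holds F V w (σ i) ⟺ (U i x ≡ true)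
    forth : ∀ {n w x w'} → Z (suc n) w x → Rel F w w' → ∃ λ x' → Rel G x x' × Z n w' x'
    forth⁻ : ∀ {n w x w'} → Z (suc n) w x → Rel F w' w → ∃ λ x' → Rel G x' x × Z n w' x'
    back : ∀ {n w x x'} → Z (suc n) w x → Rel G x x' → ∃ λ w' → Rel F w w' × Z n w' x'
    back⁻ : ∀ {n w x x'} → Z (suc n) w x → Rel G x' x → ∃ λ w' → Rel F w' w × Z n w' x'

  invariant : ∀ a {n w x} → modalDepth a ≤ n → varBound a ≤ k → Z n w x →
              Holds F V w (subst' σ a) ⟺ Holds G U x a
  invariant (var i) d b z = atom z i b
  invariant ⊥' d b z = (λ h → h) , λ h → h
  invariant (a ⇒ c) d b z with
      invariant a (m⊔n≤o⇒m≤o (modalDepth a) (modalDepth c) d) (m⊔n≤o⇒m≤o (varBound a) (varBound c) b) z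
    | invariant c (m⊔n≤o⇒n≤o (modalDepth a) (modalDepth c) d) (m⊔n≤o⇒n≤o (varBound a) (varBound c) b) z
  ... | a₁ , a₂ | c₁ , c₂ = (λ f x → c₁ (f (a₂ x))) , λ f x → c₂ (f (a₁ x))
  invariant (□ a) (s≤s d) b z =
    (λ h x' r → let w' , r' , z' = back z r in proj₁ (invariant a d b z') (h w' r')) ,
    (λ h w' r → let x' , r' , z' = forth z r in proj₂ (invariant a d b z') (h x' r'))
  invariant (■ a) (s≤s d) b z =
    (λ h x' r → let w' , r' , z' = back⁻ z r in proj₁ (invariant a d b z') (h w' r')) ,
    (λ h w' r → let x' , r' , z' = forth⁻ z r in proj₂ (invariant a d b z') (h x' r'))

subst'-var : ∀ a → subst' var a ≡ a
subst'-var (var i) = refl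
subst'-var ⊥' = refl
subst'-var (a ⇒ b) rewrite subst'-var a | subst'-var b = refl
subst'-var (□ a) = cong □ (subst'-var a)
subst'-var (■ a) = cong ■ (subst'-var a)

toFrame : FinFrame → Frame
toFrame F = frame (FinFrame.R F)

Sat⟺Holds : ∀ F V w a → Sat F V w a ⟺ Holds (toFrame F) V w a
Sat⟺Holds F V w (var i) = (λ h → h) , λ h → h
Sat⟺Holds F V w ⊥' = (λ h → h) , λ h → h
Sat⟺Holds F V w (a ⇒ b) =
  (λ f x → proj₁ (Sat⟺Holds F V w b) (f (proj₂ (Sat⟺Holds F V w a) x))) ,
  (λ f x → proj₂ (Sat⟺Holds F V w b) (f (proj₁ (Sat⟺Holds F V w a) x)))
Sat⟺Holds F V w (□ a) =
  (λ f v r → proj₁ (Sat⟺Holds F V v a) (f v r)) , (λ f v r → proj₂ (Sat⟺Holds F V v a) (f v r))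
Sat⟺Holds F V w (■ a) =
  (λ f v r → proj₁ (Sat⟺Holds F V v a) (f v r)) , (λ f v r → proj₂ (Sat⟺Holds F V v a) (f v r))

bw : (Fm → Fm) → (Fin 3 → Fm) → Fm
bw M a = (M (a zero) ∧' (M (a (suc zero)) ∧' M (a (suc (suc zero))))) ⇒
  (c zero (suc zero) ∨' (c zero (suc (suc zero)) ∨' (c (suc zero) zero ∨' (c (suc zero) (suc (suc zero)) ∨'
    (c (suc (suc zero)) zero ∨' c (suc (suc zero)) (suc zero))))))
  where
  c : Fin 3 → Fin 3 → Fm
  c i j = M (a i ∧' (a j ∨' M (a j)))

-- Reachability

Reach : ∀ {W : Set} → (W → W → Set) → ℕ → W → W → Set
Reach R zero x y = x ≡ y
Reach R (suc n) x y = ∃ λ u → Adj R x u × Reach R n u y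

Connected : ∀ {W : Set} → (W → W → Set) → Set
Connected R = ∀ x y → ∃ λ n → Reach R n x y

Antisym : ∀ {W : Set} → (W → W → Set) → Set
Antisym R = ∀ {x y} → R x y → R y x → x ≡ y

module _ {W : Set} {R : W → W → Set} where
  reach-snoc : ∀ {n x y z} → Reach R n x y → Adj R y z → Reach R (suc n) x z
  reach-snoc {zero} refl a = _ , a , refl
  reach-snoc {suc n} (u , a , r) b = u , a , reach-snoc r b

  reach-trans : ∀ {m n x y z} → Reach R m x y → Reach R n y z → Reach R (m + n) x z
  reach-trans {zero} refl s = s
  reach-trans {suc m} (u , a , r) s = u , a , reach-trans r s

  reach-sym : ∀ {n x y} → Reach R n x y → Reach R n y x
  reach-sym {zero} refl = refl
  reach-sym {suc n} (u , a , r) = reach-snoc (reach-sym r) (swap a)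

  reach-mono : (∀ {x} → R x x) → ∀ {m n x y} → m ≤ n → Reach R m x y → Reach R n x y
  reach-mono rf {n = zero} z≤n e = e
  reach-mono rf {n = suc n} z≤n refl = _ , inj₁ rf , reach-mono rf {n = n} z≤n refl
  reach-mono rf (s≤s l) (u , a , r) = u , a , reach-mono rf l r

  reach-map : ∀ {U : Set} {S : U → U → Set} (f : W → U) → (∀ {x y} → R x y → S (f x) (f y)) →
    ∀ {n x y} → Reach R n x y → Reach S n (f x) (f y)
  reach-map f h {zero} refl = refl
  reach-map f h {suc n} (u , a , r) = f u , Sum.map h h a , reach-map f h r

-- The infinite zigzag: even numbers lie below their neighbours.

even : ℕ → Bool
even zero = true
even (suc n) = not (even n)

Step : ℕ → ℕ → Set
Step i j = (suc i ≡ j) ⊎ (suc j ≡ i)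

Zigzag : ℕ → ℕ → Set
Zigzag i j = i ≡ j ⊎ (even i ≡ true × Step i j)

step-even : ∀ {i j} → Step i j → even i ≡ true → even j ≡ false
step-even (inj₁ refl) e rewrite e = refl
step-even (inj₂ refl) e = not-injective e

¬step-step : ∀ {i j} {A : Set} → Step i j → even i ≡ true → even j ≡ true → A
¬step-step s e e' with trans (sym e') (step-even s e)
... | ()

-- Only two numbers are one step away from `x`.
three-near : ∀ x (y : Fin 3 → ℕ) → (∀ i → y i ≡ x ⊎ Step x (y i)) →
  ∃ λ i → ∃ λ j → i ≢ j × (y i ≡ x ⊎ y i ≡ y j)
three-near x y h with h zero | h (suc zero) | h (suc (suc zero))
... | inj₁ e | _ | _ = zero , suc zero , (λ ()) , inj₁ e
... | _ | inj₁ e | _ = suc zero , zero , (λ ()) , inj₁ e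
... | _ | _ | inj₁ e = suc (suc zero) , zero , (λ ()) , inj₁ e
... | inj₂ (inj₁ a) | inj₂ (inj₁ b) | _ = zero , suc zero , (λ ()) , inj₂ (trans (sym a) b)
... | inj₂ (inj₂ a) | inj₂ (inj₂ b) | _ = zero , suc zero , (λ ()) , inj₂ (suc-injective (trans a (sym b)))
... | inj₂ (inj₁ a) | _ | inj₂ (inj₁ b) = zero , suc (suc zero) , (λ ()) , inj₂ (trans (sym a) b)
... | inj₂ (inj₂ a) | _ | inj₂ (inj₂ b) = zero , suc (suc zero) , (λ ()) , inj₂ (suc-injective (trans a (sym b)))
... | _ | inj₂ (inj₁ a) | inj₂ (inj₁ b) = suc zero , suc (suc zero) , (λ ()) , inj₂ (trans (sym a) b)
... | _ | inj₂ (inj₂ a) | inj₂ (inj₂ b) = suc zero , suc (suc zero) , (λ ()) , inj₂ (suc-injective (trans a (sym b)))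

zigzag-isBP : IsBP Zigzag
zigzag-isBP = record
  { R-refl = inj₁ refl
  ; R-trans = λ { (inj₁ refl) s → s ; r (inj₁ refl) → r
                ; (inj₂ (e , s)) (inj₂ (e' , _)) → ¬step-step s e e' }
  ; depth = λ { (inj₁ refl) s → inj₁ (inj₁ refl) ; r (inj₁ refl) → inj₂ (inj₁ refl)
              ; (inj₂ (e , s)) (inj₂ (e' , _)) → ¬step-step s e e' }
  ; width⁺ = λ {x} y h →
      let i , j , n , c = three-near x y (λ i → Sum.map sym proj₂ (h i))
      in i , j , n , [ (λ e → subst (λ z → Zigzag z (y j)) (sym e) (h j)) , inj₁ ]′ c
  ; width⁻ = λ {x} y h →
      let i , j , n , c = three-near x y (λ i → Sum.map (λ e → e) (λ t → swap (proj₂ t)) (h i))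
      in i , j , n , [ (λ e → subst (λ z → Zigzag (y j) z) (sym e) (h j)) , (λ e → inj₁ (sym e)) ]′ c }

zigzag-antisym : Antisym Zigzag
zigzag-antisym (inj₁ e) _ = e
zigzag-antisym _ (inj₁ e) = sym e
zigzag-antisym (inj₂ (e , s)) (inj₂ (e' , _)) = ¬step-step s e e'

zigzag-adj : ∀ {i j} → suc i ≡ j → Adj Zigzag i j
zigzag-adj {i} refl = go (even i) refl
  where
  go : ∀ b → even i ≡ b → Adj Zigzag i (suc i)
  go true e = inj₁ (inj₂ (e , inj₁ refl))
  go false e = inj₂ (inj₂ (cong not e , inj₂ refl))

adj-zigzag : ∀ {i j} → Adj Zigzag i j → j ≤ suc i
adj-zigzag (inj₁ (inj₁ refl)) = m≤n+m _ 1
adj-zigzag (inj₁ (inj₂ (_ , inj₁ refl))) = ≤-refl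
adj-zigzag (inj₁ (inj₂ (_ , inj₂ refl))) = m≤n+m _ 2
adj-zigzag (inj₂ (inj₁ refl)) = m≤n+m _ 1
adj-zigzag (inj₂ (inj₂ (_ , inj₁ refl))) = m≤n+m _ 2
adj-zigzag (inj₂ (inj₂ (_ , inj₂ refl))) = ≤-refl

zigzag-reach : ∀ n i → Reach Zigzag n i (n + i)
zigzag-reach zero i = refl
zigzag-reach (suc n) i =
  suc i , zigzag-adj refl , subst (Reach Zigzag n (suc i)) (+-suc n i) (zigzag-reach n (suc i))

reach-zigzag : ∀ {n i j} → Reach Zigzag n i j → j ≤ n + i
reach-zigzag {zero} refl = ≤-refl
reach-zigzag {suc n} {i} (u , a , r) =
  ≤-trans (reach-zigzag r) (≤-trans (+-monoʳ-≤ n (adj-zigzag a)) (≤-reflexive (+-suc n i)))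

-- Frames with one infinite cluster: the blow-up of a coded frame replaces its
-- distinguished point by infinitely many copies.

Entry : ∀ {n} → Matrix n → Fin n → Fin n → Set
Entry m i j = entry m i j ≡ true

module _ (c : PointedCode) where
  open PointedCode c

  collapse : Fin size ⊎ ℕ → Fin size
  collapse (inj₁ i) = i
  collapse (inj₂ _) = point

  blowup : Frame
  blowup = frame (λ v w → Entry matrix (collapse v) (collapse w))

  -- The length is positive because distinct copies of the distinguished point lie over a path of
  -- length 0, which does not lift.
  blowup-reach : ∀ {n v w} → Reach (Entry matrix) (suc n) (collapse v) (collapse w) → Reach (Frame.Rel blowup) (suc n) v w
  blowup-reach {zero} {w = w} (_ , a , refl) = w , a , refl
  blowup-reach {suc n} (u , a , r) = inj₁ u , a , blowup-reach {n} {inj₁ u} r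

frameOf : Maybe PointedCode → Frame
frameOf nothing = frame Zigzag
frameOf (just c) = blowup c

indexLogic : Maybe PointedCode → Logic
indexLogic i = Log (frameOf i)

-- Antisymmetry leaves the blown-up point as the only non-degenerate cluster and lets the points of
-- a code be counted as clusters.
Good : Maybe PointedCode → Set
Good nothing = ⊤
Good (just c) = IsBP (Entry matrix) × Connected (Entry matrix) × Antisym (Entry matrix)
  where open PointedCode c

frameOf-isBP : ∀ i → Good i → IsBP (Frame.Rel (frameOf i))
frameOf-isBP nothing _ = zigzag-isBP
frameOf-isBP (just c) (bp , _) = pullback-isBP (collapse c) (λ _ _ → (λ h → h) , λ h → h) bp

-- Formulas for distance and for counting points

within : ℕ → Fm → Fm
within zero a = a
within (suc n) a = ◇ (within n a) ∨' 𝖯 (within n a)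

⊤' : Fm
⊤' = ¬' ⊥'

noneBelow : ℕ → Fm
noneBelow zero = ⊤'
noneBelow (suc i) = ¬' (var i) ∧' noneBelow i

-- exceeds r m holds at a point under some valuation iff at least m points lie within
-- distance r of it: the i-th of them is marked by the i-th variable.
exceeds : ℕ → ℕ → Fm
exceeds r zero = ⊤'
exceeds r (suc m) = exceeds r m ∧' within r (var m ∧' noneBelow m)

⋀ : ∀ {n} → (Fin n → Fm) → Fm
⋀ {zero} a = ⊤'
⋀ {suc n} a = a zero ∧' ⋀ (λ i → a (suc i))

unless : ∀ {A : Set} → Dec A → Fm → Fm
unless (yes _) a = ⊤'
unless (no _) a = a

-- Canonical models

record CanonicalModel (L : Logic) : Set₁ where
  field
    F : Frame
    V : Valuation F
    valid : ∀ {a} → L a → ∀ w → Holds F V w a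
    complete : ∀ {a} → (∀ w → Holds F V w a) → L a
    tight : ∀ {w v} → (∀ a → Holds F V w (□ a) → Holds F V v a) → Frame.Rel F w v

-- Finite covers and transversals

module _ {W : Set} (E : W → W → Set) (P : W → Set) where
  Scattered : ℕ → Set
  Scattered n = Σ (Fin n → W) λ f → (∀ i → P (f i)) × (∀ i j → i ≢ j → ¬ E (f i) (f j))

  Transversal : ℕ → Set
  Transversal n = Σ (Scattered n) λ s → ∀ w → P w → ∃ λ i → E (proj₁ s i) w

  Covers : List W → Set
  Covers l = ∀ w → P w → Any (λ y → E y w) l

scattered≤cover : ∀ {W : Set} {E : W → W → Set} {P : W → Set} →
  (∀ {x y} → E x y → E y x) → (∀ {x y z} → E x y → E y z → E x z) →
  ∀ {n l} → Scattered E P n → Covers E P l → n ≤ length l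
scattered≤cover {E = E} sy tr {n} {l} (f , fP , fE) c = ≮⇒≥ λ lt →
  let i , j , i<j , e = pigeonhole lt (λ i → index (c (f i) (fP i)))
      E-at = λ i → lookup-index (c (f i) (fP i))
  in fE i j (<⇒≢ i<j) (tr (sy (E-at i)) (subst (λ k → E (lookup l k) (f j)) (sym e) (E-at j)))

length-concatMap : ∀ {A B : Set} {f : A → List B} {c} → (∀ x → length (f x) ≤ c) →
  ∀ l → length (concatMap f l) ≤ length l * c
length-concatMap h [] = z≤n
length-concatMap {f = f} h (x ∷ l) =
  ≤-trans (≤-reflexive (length-++ (f x))) (+-mono-≤ (h x) (length-concatMap h l))

covers-concatMap : ∀ {W : Set} {E E' : W → W → Set} {P Q : W → Set} {l} (f : W → List W) → Covers E P l →
  (∀ w → Q w → ∃ λ v → P v × ∀ y → E y v → Any (λ z → E' z w) (f y)) → Covers E' Q (concatMap f l)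
covers-concatMap f c h w q = let v , p , k = h w q in concatMap⁺ f (Any.map (λ {y} → k y) (c v p))

-- Disjoint unions

-- A bounded morphism for `□` and `■` together.
record Generated (G F : Frame) (f : Frame.World G → Frame.World F) : Set where
  field
    preserves : ∀ {x y} → Frame.Rel G x y → Frame.Rel F (f x) (f y)
    closed : ∀ {x w} → Frame.Rel F (f x) w → ∃ λ y → f y ≡ w × Frame.Rel G x y
    closed⁻ : ∀ {x w} → Frame.Rel F w (f x) → ∃ λ y → f y ≡ w × Frame.Rel G y x

  holds : ∀ {V : Valuation F} {U : Valuation G} → (∀ i x → V i (f x) ≡ U i x) →
    ∀ a x → Holds F V (f x) a ⟺ Holds G U x a
  holds {V} {U} h a x = subst (λ b → Holds F V (f x) b ⟺ Holds G U x a) (subst'-var a)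
    (Bisim.invariant bisim a ≤-refl ≤-refl refl)
    where
    bisim : Bisim F G V U var (varBound a) (λ _ w y → f y ≡ w)
    bisim = record
      { atom = λ { {x = y} refl i _ → trans (sym (h i y)) , trans (h i y) }
      ; forth = λ { refl r → let y , e , s = closed r in y , s , e }
      ; forth⁻ = λ { refl r → let y , e , s = closed⁻ r in y , s , e }
      ; back = λ { refl r → _ , preserves r , refl }
      ; back⁻ = λ { refl r → _ , preserves r , refl } }

unionRel : ∀ {A B : Set} → (A → A → Set) → (B → B → Set) → A ⊎ B → A ⊎ B → Set
unionRel R S (inj₁ x) (inj₁ y) = R x y
unionRel R S (inj₁ x) (inj₂ y) = ⊥
unionRel R S (inj₂ x) (inj₁ y) = ⊥
unionRel R S (inj₂ x) (inj₂ y) = S x y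

module Union (F G : FinFrame) where
  open FinFrame F renaming (size to m; R to R₁)
  open FinFrame G renaming (size to n; R to R₂)

  union : FinFrame
  union = record { size = m + n ; R = λ i j → unionRel R₁ R₂ (splitAt m i) (splitAt m j) }

  left-generated : Generated (toFrame F) (toFrame union) (_↑ˡ n)
  left-generated = record { preserves = pr ; closed = cl _ ; closed⁻ = cl⁻ _ }
    where
    pr : ∀ {x y} → R₁ x y → FinFrame.R union (x ↑ˡ n) (y ↑ˡ n)
    pr {x} {y} r rewrite splitAt-↑ˡ m x n | splitAt-↑ˡ m y n = r
    cl : ∀ x {w} → FinFrame.R union (x ↑ˡ n) w → ∃ λ y → y ↑ˡ n ≡ w × R₁ x y
    cl x {w} r rewrite splitAt-↑ˡ m x n with splitAt m w in e
    ... | inj₁ y = y , splitAt⁻¹-↑ˡ e , r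
    cl⁻ : ∀ x {w} → FinFrame.R union w (x ↑ˡ n) → ∃ λ y → y ↑ˡ n ≡ w × R₁ y x
    cl⁻ x {w} r rewrite splitAt-↑ˡ m x n with splitAt m w in e
    ... | inj₁ y = y , splitAt⁻¹-↑ˡ e , r

  right-generated : Generated (toFrame G) (toFrame union) (m ↑ʳ_)
  right-generated = record { preserves = pr ; closed = cl _ ; closed⁻ = cl⁻ _ }
    where
    pr : ∀ {x y} → R₂ x y → FinFrame.R union (m ↑ʳ x) (m ↑ʳ y)
    pr {x} {y} r rewrite splitAt-↑ʳ m n x | splitAt-↑ʳ m n y = r
    cl : ∀ x {w} → FinFrame.R union (m ↑ʳ x) w → ∃ λ y → m ↑ʳ y ≡ w × R₂ x y
    cl x {w} r rewrite splitAt-↑ʳ m n x with splitAt m w in e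
    ... | inj₂ y = y , splitAt⁻¹-↑ʳ e , r
    cl⁻ : ∀ x {w} → FinFrame.R union w (m ↑ʳ x) → ∃ λ y → m ↑ʳ y ≡ w × R₂ y x
    cl⁻ x {w} r rewrite splitAt-↑ʳ m n x with splitAt m w in e
    ... | inj₂ y = y , splitAt⁻¹-↑ʳ e , r

  Log-union : ∀ a → Log (toFrame union) a ⟺ (Log (toFrame F) a × Log (toFrame G) a)
  Log-union a = to , from
    where
    to : Log (toFrame union) a → Log (toFrame F) a × Log (toFrame G) a
    to h =
      (λ V x → proj₁ (Generated.holds left-generated
         {λ i w → [ V i , (λ _ → false) ]′ (splitAt m w)} {V} (λ i x → cong [ V i , (λ _ → false) ]′ (splitAt-↑ˡ m x n)) a x) (h _ _)) ,
      (λ V x → proj₁ (Generated.holds right-generated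
         {λ i w → [ (λ _ → false) , V i ]′ (splitAt m w)} {V} (λ i x → cong [ (λ _ → false) , V i ]′ (splitAt-↑ʳ m n x)) a x) (h _ _))
    from : Log (toFrame F) a × Log (toFrame G) a → Log (toFrame union) a
    from (h , k) V w with splitAt m w in e
    ... | inj₁ x = subst (λ w → Holds (toFrame union) V w a) (splitAt⁻¹-↑ˡ e)
      (proj₂ (Generated.holds left-generated {V} (λ _ _ → refl) a x) (h _ x))
    ... | inj₂ x = subst (λ w → Holds (toFrame union) V w a) (splitAt⁻¹-↑ʳ e)
      (proj₂ (Generated.holds right-generated {V} (λ _ _ → refl) a x) (k _ x))

codeFrame : Code → FinFrame
codeFrame (n , m) = record { size = n ; R = Entry m }

-- Local structure of frames of depth and width at most two

flip-isBP : ∀ {W : Set} {R : W → W → Set} → IsBP R → IsBP (flip R)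
flip-isBP bp = record
  { R-refl = R-refl ; R-trans = λ r s → R-trans s r ; depth = λ r s → swap (depth s r)
  ; width⁺ = width⁻ ; width⁻ = width⁺ }
  where open IsBP bp

Cluster : ∀ {W : Set} → (W → W → Set) → W → W → Set
Cluster R x y = R x y × R y x

module Local {W : Set} {R : W → W → Set} (bp : IsBP R) where
  open IsBP bp

  cluster-refl : ∀ {x} → Cluster R x x
  cluster-refl = R-refl , R-refl

  cluster-sym : ∀ {x y} → Cluster R x y → Cluster R y x
  cluster-sym (r , s) = s , r

  cluster-trans : ∀ {x y z} → Cluster R x y → Cluster R y z → Cluster R x z
  cluster-trans (r , s) (r' , s') = R-trans r r' , R-trans s' s

  -- Depth two leaves no room for another cluster below a point that already lies strictly below
  -- `a`.
  minimal : ∀ {y a} → ¬ Cluster R y a → R y a → ∀ {w} → R w y → Cluster R w y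
  minimal n r s with depth s r
  ... | inj₁ t = s , t
  ... | inj₂ t = ⊥-elim (n (r , t))

  module Fork {y a b} (y≁a : ¬ Cluster R y a) (y≁b : ¬ Cluster R y b) (a≁b : ¬ Cluster R a b) (ya : R y a) where

    -- With `b` below `y` instead, `b`, `y`, `a` would be a chain of three clusters.
    other-prong : Adj R y b → R y b
    other-prong (inj₁ r) = r
    other-prong (inj₂ s) = proj₂ (minimal y≁a ya s)

    -- The width bound relates two of `a`, `b`, `w`; depth then merges their clusters or sends the
    -- first of them back to `y`, and the separation hypotheses exclude the other outcomes.
    prongs : R y b → ∀ {w} → R y w → Cluster R w y ⊎ Cluster R w a ⊎ Cluster R w b
    prongs yb {w} yw with width⁺ (λ { zero → a ; (suc zero) → b ; (suc (suc zero)) → w })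
                                 (λ { zero → ya ; (suc zero) → yb ; (suc (suc zero)) → yw })
    ... | zero , zero , n , r = ⊥-elim (n refl)
    ... | suc zero , suc zero , n , r = ⊥-elim (n refl)
    ... | suc (suc zero) , suc (suc zero) , n , r = ⊥-elim (n refl)
    ... | zero , suc zero , n , r = [ (λ s → ⊥-elim (y≁a (ya , s))) , (λ s → ⊥-elim (a≁b (r , s))) ]′ (depth ya r)
    ... | suc zero , zero , n , r = [ (λ s → ⊥-elim (y≁b (yb , s))) , (λ s → ⊥-elim (a≁b (s , r))) ]′ (depth yb r)
    ... | zero , suc (suc zero) , n , r = [ (λ s → ⊥-elim (y≁a (ya , s))) , (λ s → inj₂ (inj₁ (s , r))) ]′ (depth ya r)
    ... | suc zero , suc (suc zero) , n , r = [ (λ s → ⊥-elim (y≁b (yb , s))) , (λ s → inj₂ (inj₂ (s , r))) ]′ (depth yb r)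
    ... | suc (suc zero) , zero , n , r = [ (λ s → inj₁ (s , yw)) , (λ s → inj₂ (inj₁ (r , s))) ]′ (depth yw r)
    ... | suc (suc zero) , suc zero , n , r = [ (λ s → inj₁ (s , yw)) , (λ s → inj₂ (inj₂ (r , s))) ]′ (depth yw r)

  -- Distance is counted from a whole cluster, so that every ball is a union of clusters.
  Ball : W → ℕ → W → Set
  Ball x zero w = Cluster R x w
  Ball x (suc n) w = ∃ λ v → Ball x n v × Adj R v w

  Level : W → ℕ → W → Set
  Level x zero w = Ball x zero w
  Level x (suc n) w = Ball x (suc n) w × ¬ Ball x n w

  ball-suc : ∀ {x n w} → Ball x n w → Ball x (suc n) w
  ball-suc b = _ , b , inj₁ R-refl

  ball-mono : ∀ {x m n w} → m ≤ n → Ball x m w → Ball x n w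
  ball-mono {n = zero} z≤n b = b
  ball-mono {m = zero} {n = suc n} z≤n b = ball-suc {n = n} (ball-mono {m = zero} {n = n} z≤n b)
  ball-mono (s≤s l) (v , b , a) = v , ball-mono l b , a

  adj-cluster : ∀ {v w w'} → Adj R v w → Cluster R w w' → Adj R v w'
  adj-cluster (inj₁ r) (s , _) = inj₁ (R-trans r s)
  adj-cluster (inj₂ r) (_ , s) = inj₂ (R-trans s r)

  ball-cluster : ∀ {x n w w'} → Ball x n w → Cluster R w w' → Ball x n w'
  ball-cluster {n = zero} b c = cluster-trans b c
  ball-cluster {n = suc n} (v , b , a) c = v , b , adj-cluster a c

  level⇒ball : ∀ {x n w} → Level x n w → Ball x n w
  level⇒ball {n = zero} l = l
  level⇒ball {n = suc n} l = proj₁ l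

  ¬level-below : ∀ {x m n w w'} → m < n → Level x m w → Level x n w' → ¬ Cluster R w w'
  ¬level-below {x} {m} {suc n} (s≤s l) lw (_ , nb) c =
    nb (ball-mono {x} {m} {n} l (ball-cluster {n = m} (level⇒ball {n = m} lw) c))

  level-unique : ∀ {x m n w w'} → Level x m w → Level x n w' → Cluster R w w' → m ≡ n
  level-unique {x} {m} {n} l l' c with <-cmp m n
  ... | tri< lt _ _ = ⊥-elim (¬level-below lt l l' c)
  ... | tri≈ _ e _ = e
  ... | tri> _ _ gt = ⊥-elim (¬level-below gt l' l (cluster-sym c))

  record Path (m : ℕ) : Set where
    field
      z : ℕ → W
      adjacent : ∀ i → i < m → Adj R (z i) (z (suc i))
      distinct : ∀ {i j} → i ≤ m → j ≤ m → Cluster R (z i) (z j) → i ≡ j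

  private
    -- The witness `v` for `w` cannot lie in a smaller ball, as `w` would then lie in `Ball x m`; so
    -- the level drops by exactly one at each step.
    descend : ∀ {x} m {w} → Level x m w → ∃ λ (z : ℕ → W) → z 0 ≡ w ×
      (∀ i j → i + j ≡ m → Level x j (z i)) × (∀ i → i < m → Adj R (z i) (z (suc i)))
    descend zero {w} l = (λ _ → w) , refl , (λ { zero .zero refl → l }) , λ _ ()
    descend {x} (suc m) {w} ((v , b , a) , nb) with descend {x} m {v} (v-level m b nb)
      where
      v-level : ∀ m → Ball x m v → ¬ Ball x m w → Level x m v
      v-level zero b nb = b
      v-level (suc m) b nb = b , λ b' → nb (v , b' , a)
    ... | z , refl , lev , adj = z' , refl , lev' , adj'
      where
      z' : ℕ → W
      z' zero = w
      z' (suc i) = z i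
      lev' : ∀ i j → i + j ≡ suc m → Level x j (z' i)
      lev' zero .(suc m) refl = (v , b , a) , nb
      lev' (suc i) j e = lev i j (suc-injective e)
      adj' : ∀ i → i < suc m → Adj R (z' i) (z' (suc i))
      adj' zero _ = swap a
      adj' (suc i) (s≤s l) = adj i l

  -- Points on different levels lie in different clusters, which makes the path simple.
  geodesic : ∀ {x m w} → Level x m w → Path m
  geodesic {x} {m} l with descend {x} m l
  ... | z , _ , lev , adj = record
    { z = z
    ; adjacent = adj
    ; distinct = λ {i} {j} i≤m j≤m c →
        let ei = m+[n∸m]≡n i≤m
            ej = m+[n∸m]≡n j≤m
            e = level-unique {x} (lev i _ ei) (lev j _ ej) c
        in +-cancelʳ-≡ _ i j (trans ei (trans (sym ej) (cong (j +_) (sym e)))) }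

-- Folding a path onto the zigzag

true≢false : ¬ true ≡ false
true≢false ()

-- The direction of the edge number `n` on a zigzagging path whose first edge has direction `b`.
alternate : Bool → ℕ → Bool
alternate b zero = b
alternate b (suc n) = alternate (not b) n

alternate-not : ∀ b n → alternate (not b) n ≡ not (alternate b n)
alternate-not b zero = refl
alternate-not b (suc n) = alternate-not (not b) n

alternate-even : ∀ n → alternate true n ≡ even n
alternate-even zero = refl
alternate-even (suc n) = trans (alternate-not true n) (cong not (alternate-even n))

-- Both sides flip with each step of `j`, and they agree at `j = s`.
even-distance : ∀ b s j → alternate b s ≡ true → even ∣ s - j ∣ ≡ alternate b j
even-distance .true zero j refl = sym (alternate-even j)
even-distance true (suc s) zero e = trans (sym (alternate-even (suc s))) e
even-distance false (suc s) zero e = cong not (trans (sym (alternate-even s)) e)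
even-distance b (suc s) (suc j) e = even-distance (not b) s j e

distance-step : ∀ s j → Step ∣ s - j ∣ ∣ s - suc j ∣
distance-step zero j = inj₁ refl
distance-step (suc s) zero = inj₂ (cong suc (∣-∣-identityʳ s))
distance-step (suc s) (suc j) = distance-step s j

-- The back property of reflection at `s`; at the crease the value is 0, whose only neighbour is the
-- image of both sides.
step-distance : ∀ s j {i} → Step ∣ s - suc j ∣ i → i ≡ ∣ s - j ∣ ⊎ i ≡ ∣ s - suc (suc j) ∣
step-distance zero j (inj₁ refl) = inj₂ refl
step-distance zero j (inj₂ refl) = inj₁ refl
step-distance (suc zero) zero (inj₁ refl) = inj₁ refl
step-distance (suc (suc s)) zero (inj₁ refl) = inj₁ refl
step-distance (suc (suc s)) zero (inj₂ refl) = inj₂ (sym (∣-∣-identityʳ s))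
step-distance (suc s) (suc j) st = step-distance s j st

-- Uniform bounds and bit patterns

uniform-bound : ∀ {A : Set} (P : A → ℕ → Set) → (∀ {a m n} → m ≤ n → P a m → P a n) →
  (∀ a → ∃ (P a)) → ∀ l → ∃ λ n → ∀ a → a ∈ l → P a n
uniform-bound P mono h [] = 0 , λ _ ()
uniform-bound P mono h (a ∷ l) with h a | uniform-bound P mono h l
... | m , p | n , q = m ⊔ n , λ
  { .a (here refl) → mono (m≤m⊔n m n) p
  ; b (there i) → mono (m≤n⊔m m n) (q b i) }

scattered-mono : ∀ {W : Set} (E : W → W → Set) (P : W → Set) {m n} → m ≤ n → Scattered E P n → Scattered E P m
scattered-mono E P l (f , fP , fE) = (λ i → f (inject≤ i l)) , (λ i → fP _) ,
  λ i j n → fE _ _ λ e → n (inject≤-injective l l i j e)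

transversal-list : ∀ {W : Set} {E : W → W → Set} {P : W → Set} {n} → Transversal E P n →
  ∃ λ l → length l ≡ n × Covers E P l
transversal-list ((f , _) , c) = tabulate f , length-tabulate f , λ w p → let i , e = c w p in tabulate⁺ i e

bits : ∀ k → (ℕ → Bool) → Fin (2 ^ k)
bits k V = funToFin {k} λ i → if V (toℕ i) then suc zero else zero

bits-injective : ∀ k {U V : ℕ → Bool} → bits k U ≡ bits k V → ∀ i → i < k → U i ≡ V i
bits-injective k {U} {V} e i l = subst (λ j → U j ≡ V j) (toℕ-fromℕ< l) (bit-injective _ _ (at (fromℕ< l)))
  where
  bit-injective : ∀ a b → _≡_ {A = Fin 2} (if a then suc zero else zero) (if b then suc zero else zero) → a ≡ b
  bit-injective true true _ = refl
  bit-injective false false _ = refl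
  at : ∀ i → _≡_ {A = Fin 2} (if U (toℕ i) then suc zero else zero) (if V (toℕ i) then suc zero else zero)
  at i = trans (sym (finToFun-funToFin {k} (λ i → if U (toℕ i) then suc zero else zero) i))
    (trans (cong (λ c → finToFun {2} {k} c i) e) (finToFun-funToFin {k} (λ i → if V (toℕ i) then suc zero else zero) i))

-- Formulas true in fences

-- Recognises non-degenerate clusters: a point alone in its cluster is minimal or maximal in depth
-- two, and in one direction it sees only itself, so not both `p` and its negation.
splitting : Fm
splitting = (◇ p ∧' ◇ (¬' p)) ∧' (𝖯 p ∧' 𝖯 (¬' p))

-- Read with `p` true at one point only. A formula looks boundedly far, hence the parameter `K`; all
-- its values are used together.
diameter≤ : ℕ → ℕ → Fm
diameter≤ K k = p ⇒ ¬' (within K (¬' (within k p)))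

-- `splitting` acts as a name for the infinite cluster, from which some point is then more than `k`
-- steps away.
eccentricity> : ℕ → Fm
eccentricity> k = splitting ⇒ within (suc k) (¬' (within k splitting))

reach⇒ball : ∀ {W : Set} {R : W → W → Set} (bp : IsBP R) →
  ∀ {x m n v w} → Local.Ball bp x m v → Reach R n v w → Local.Ball bp x (n + m) w
reach⇒ball bp {n = zero} b refl = b
reach⇒ball bp {x} {m} {suc n} {w = w} b (u , a , r) =
  subst (λ k → Local.Ball bp x k w) (+-suc n m) (reach⇒ball bp {x} {suc m} {n} (_ , b , a) r)

ExtS4BP-mono : ∀ {L L'} → ExtS4BP L → IsNTL L' → L ⊆L L' → ExtS4BP L'
ExtS4BP-mono (_ , a , b , c , d , e) n s = n , s _ a , s _ b , s _ c , s _ d , s _ e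

-- Classical logic

module Classical (em : ExcludedMiddle) where

  dne : ∀ {A : Set} → ¬ ¬ A → A
  dne {A} h with em A
  ... | inj₁ a = a
  ... | inj₂ n = ⊥-elim (h n)

  ¬∀⇒∃ : ∀ {A : Set} {B : A → Set} → ¬ (∀ x → B x) → ∃ λ x → ¬ B x
  ¬∀⇒∃ h = dne λ n → h λ x → dne λ b → n (x , b)

  ¬→⇒× : ∀ {A B : Set} → ¬ (A → B) → A × ¬ B
  ¬→⇒× h = dne (λ n → h λ a → dne λ b → n (a , b))

  truth : Set → Bool
  truth A with em A
  ... | inj₁ _ = true
  ... | inj₂ _ = false

  truth⁺ : ∀ {A} → A → truth A ≡ true
  truth⁺ {A} a with em A
  ... | inj₁ _ = refl
  ... | inj₂ n = ⊥-elim (n a)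

  truth⁻ : ∀ {A} → truth A ≡ true → A
  truth⁻ {A} e with em A
  ... | inj₁ a = a

  -- Classical readings of the implicational encodings of ∧', ∨' and the diamonds.

  ∧-elim : ∀ {A B : Set} → ((A → B → ⊥) → ⊥) → A × B
  ∧-elim h = dne λ n → h λ a b → n (a , b)

  ∧-intro : ∀ {A B : Set} → A → B → (A → B → ⊥) → ⊥
  ∧-intro a b f = f a b

  ∨-elim : ∀ {A B : Set} → ((A → ⊥) → B) → A ⊎ B
  ∨-elim {A} h with em A
  ... | inj₁ a = inj₁ a
  ... | inj₂ n = inj₂ (h n)

  ∨-intro : ∀ {A B : Set} → A ⊎ B → (A → ⊥) → B
  ∨-intro (inj₁ a) n = ⊥-elim (n a)
  ∨-intro (inj₂ b) n = b

  ◇-elim : ∀ {W : Set} {P Q : W → Set} → ((∀ v → P v → Q v → ⊥) → ⊥) → ∃ λ v → P v × Q v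
  ◇-elim h = dne λ n → h λ v p q → n (v , p , q)

  ◇-intro : ∀ {W : Set} {P Q : W → Set} v → P v → Q v → (∀ v → P v → Q v → ⊥) → ⊥
  ◇-intro v p q f = f v p q

  LogF⇒Log : ∀ F → LogF F ⊆L Log (toFrame F)
  LogF⇒Log F a h V w = proj₁ (Sat⟺Holds F V w a) (h V w)

  Log⇒LogF : ∀ F → Log (toFrame F) ⊆L LogF F
  Log⇒LogF F a h V w = proj₂ (Sat⟺Holds F V w a) (h V w)

  -- The axioms and their frame conditions

  module Semantics (F : Frame) (V : Valuation F) where

    substituted : (ℕ → Fm) → Valuation F
    substituted σ i w = truth (Holds F V w (σ i))

    subst-lemma : ∀ σ a w → Holds F V w (subst' σ a) ⟺ Holds F (substituted σ) w a
    subst-lemma σ a w = Bisim.invariant bisim a ≤-refl ≤-refl refl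
      where
      bisim : Bisim F F V (substituted σ) σ (varBound a) (λ _ x y → x ≡ y)
      bisim = record
        { atom = λ { refl i _ → truth⁺ , truth⁻ }
        ; forth = λ { refl r → _ , r , refl } ; forth⁻ = λ { refl r → _ , r , refl }
        ; back = λ { refl r → _ , r , refl } ; back⁻ = λ { refl r → _ , r , refl } }

    module Width (M : Fm → Fm) (S : World F → World F → Set)
                 (M-holds : ∀ {w} a → Holds F V w (M a) ⟺ ∃ λ v → S w v × Holds F V v a) where

      Comparable : World F → (Fin 3 → Fm) → Fin 3 → Fin 3 → Set
      Comparable w a i j = ∃ λ v → S w v × Holds F V v (a i) ×
        (Holds F V v (a j) ⊎ ∃ λ u → S v u × Holds F V u (a j))

      comparable : ∀ {w a} i j →
        Holds F V w (M (a i ∧' (a j ∨' M (a j)))) ⟺ Comparable w a i j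
      comparable {w} {a} i j =
        (λ h → let v , s , t = proj₁ (M-holds _) h
                   t₁ , t₂ = ∧-elim t
               in v , s , t₁ , [ inj₁ , (λ m → inj₂ (proj₁ (M-holds _) m)) ]′ (∨-elim t₂)) ,
        (λ (v , s , t₁ , t₂) → proj₂ (M-holds _) (v , s , ∧-intro t₁
          (∨-intro ([ inj₁ , (λ m → inj₂ (proj₂ (M-holds _) m)) ]′ t₂))))

      -- One equivalence serves both soundness on frames of width two and canonicity of the width
      -- axioms.
      bw-holds : ∀ {w a} → Holds F V w (bw M a) ⟺
        ((∀ i → ∃ λ v → S w v × Holds F V v (a i)) → ∃ λ i → ∃ λ j → i ≢ j × Comparable w a i j)
      bw-holds {w} {a} = to , from
        where
        c = λ i j → proj₁ (comparable {w} {a} i j)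
        d = λ i j → proj₂ (comparable {w} {a} i j)
        to : Holds F V w (bw M a) →
          ((∀ i → ∃ λ v → S w v × Holds F V v (a i)) → ∃ λ i → ∃ λ j → i ≢ j × Comparable w a i j)
        to h k with ∨-elim (h (∧-intro (proj₂ (M-holds _) (k _))
                      (∧-intro (proj₂ (M-holds _) (k _)) (proj₂ (M-holds _) (k _)))))
        ... | inj₁ x = _ , _ , (λ ()) , c zero (suc zero) x
        ... | inj₂ h with ∨-elim h
        ... | inj₁ x = _ , _ , (λ ()) , c zero (suc (suc zero)) x
        ... | inj₂ h with ∨-elim h
        ... | inj₁ x = _ , _ , (λ ()) , c (suc zero) zero x
        ... | inj₂ h with ∨-elim h
        ... | inj₁ x = _ , _ , (λ ()) , c (suc zero) (suc (suc zero)) x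
        ... | inj₂ h with ∨-elim h
        ... | inj₁ x = _ , _ , (λ ()) , c (suc (suc zero)) zero x
        ... | inj₂ x = _ , _ , (λ ()) , c (suc (suc zero)) (suc zero) x
        from : ((∀ i → ∃ λ v → S w v × Holds F V v (a i)) → ∃ λ i → ∃ λ j → i ≢ j × Comparable w a i j) →
          Holds F V w (bw M a)
        from f h = pick (f ms)
          where
          ms : ∀ i → ∃ λ v → S w v × Holds F V v (a i)
          ms zero = proj₁ (M-holds _) (proj₁ (∧-elim h))
          ms (suc zero) = proj₁ (M-holds _) (proj₁ (∧-elim (proj₂ (∧-elim h))))
          ms (suc (suc zero)) = proj₁ (M-holds _) (proj₂ (∧-elim (proj₂ (∧-elim h))))
          pick : (∃ λ i → ∃ λ j → i ≢ j × Comparable w a i j) → _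
          pick (zero , zero , n , x) = ⊥-elim (n refl)
          pick (zero , suc zero , n , x) = ∨-intro (inj₁ (d _ _ x))
          pick (zero , suc (suc zero) , n , x) = ∨-intro (inj₂ (∨-intro (inj₁ (d _ _ x))))
          pick (suc zero , zero , n , x) = ∨-intro (inj₂ (∨-intro (inj₂ (∨-intro (inj₁ (d _ _ x))))))
          pick (suc zero , suc zero , n , x) = ⊥-elim (n refl)
          pick (suc zero , suc (suc zero) , n , x) =
            ∨-intro (inj₂ (∨-intro (inj₂ (∨-intro (inj₂ (∨-intro (inj₁ (d _ _ x))))))))
          pick (suc (suc zero) , zero , n , x) =
            ∨-intro (inj₂ (∨-intro (inj₂ (∨-intro (inj₂ (∨-intro (inj₂ (∨-intro (inj₁ (d _ _ x))))))))))
          pick (suc (suc zero) , suc zero , n , x) =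
            ∨-intro (inj₂ (∨-intro (inj₂ (∨-intro (inj₂ (∨-intro (inj₂ (∨-intro (inj₂ (d _ _ x))))))))))
          pick (suc (suc zero) , suc (suc zero) , n , x) = ⊥-elim (n refl)

    ◇-holds : ∀ {w} a → Holds F V w (◇ a) ⟺ ∃ λ v → Rel F w v × Holds F V v a
    ◇-holds a = ◇-elim , λ (v , r , h) → ◇-intro v r h

    𝖯-holds : ∀ {w} a → Holds F V w (𝖯 a) ⟺ ∃ λ v → Rel F v w × Holds F V v a
    𝖯-holds a = ◇-elim , λ (v , r , h) → ◇-intro v r h

    module Forward = Width ◇ (Rel F) ◇-holds
    module Backward = Width 𝖯 (flip (Rel F)) 𝖯-holds

  Log-isNTL : ∀ F → IsNTL (Log F)
  Log-isNTL F = record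
    { ax1 = λ V w a b → a
    ; ax2 = λ V w f g a → f a (g a)
    ; ax3 = λ V w → dne
    ; K□ = λ V w f g v r → f v r (g v r)
    ; K■ = λ V w f g v r → f v r (g v r)
    ; conv□ = λ V w a v r → ◇-intro w r a
    ; conv■ = λ V w a v r → ◇-intro w r a
    ; mp = λ f a V w → f V w (a V w)
    ; sub = λ σ {a} h V w → proj₂ (Semantics.subst-lemma F V σ a w) (h _ w)
    ; nec□ = λ h V w v r → h V v
    ; nec■ = λ h V w v r → h V v }

  Log-extendsS4BP : ∀ F → IsBP (Rel F) → ExtS4BP (Log F)
  Log-extendsS4BP F bp = Log-isNTL F ,
    (λ V w h → h w R-refl) ,
    (λ V w h v r u s → h u (R-trans r s)) ,
    bd2-holds ,
    (λ V w → proj₂ (Semantics.Forward.bw-holds F V {a = λ { zero → p0 ; (suc zero) → p1 ; (suc (suc zero)) → p2 }})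
      (λ f → let i , j , n , r = width⁺ (λ i → proj₁ (f i)) (λ i → proj₁ (proj₂ (f i)))
             in i , j , n , _ , proj₁ (proj₂ (f i)) , proj₂ (proj₂ (f i)) , inj₂ (_ , r , proj₂ (proj₂ (f j))))) ,
    (λ V w → proj₂ (Semantics.Backward.bw-holds F V {a = λ { zero → p0 ; (suc zero) → p1 ; (suc (suc zero)) → p2 }})
      (λ f → let i , j , n , r = width⁻ (λ i → proj₁ (f i)) (λ i → proj₁ (proj₂ (f i)))
             in i , j , n , _ , proj₁ (proj₂ (f i)) , proj₂ (proj₂ (f i)) , inj₂ (_ , r , proj₂ (proj₂ (f j)))))
    where
    open IsBP bp
    -- Failure of `bd1` at `v` gives a point `u` above with `□ p0` and excludes a return from `u` to
    -- `v`; so depth forces `v` to see `w`.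
    bd2-holds : Log F bd2
    bd2-holds V w h with ◇-elim h
    ... | v , r , t with ∧-elim t
    ... | □p1 , t with ¬→⇒× t
    ... | d , ¬p0 with ◇-elim d
    ... | u , s , □p0 with depth r s
    ... | inj₁ x = □p1 w x
    ... | inj₂ x = ⊥-elim (¬p0 (□p0 v x))

  -- Boolean codes of relations and finite fences

  module _ {n : ℕ} (R : Fin n → Fin n → Set) where
    encode : Matrix n
    encode = Vec.tabulate λ i → Vec.tabulate λ j → truth (R i j)

    entry-encode : ∀ i j → entry encode i j ≡ truth (R i j)
    entry-encode i j = trans
      (cong (λ v → Vec.lookup v j) (lookup∘tabulate (λ i → Vec.tabulate λ j → truth (R i j)) i))
      (lookup∘tabulate (λ j → truth (R i j)) j)

    encode-spec : ∀ i j → Entry encode i j ⟺ R i j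
    encode-spec i j = (λ e → truth⁻ (trans (sym (entry-encode i j)) e)) ,
                      (λ r → trans (entry-encode i j) (truth⁺ r))

  abstract
    fenceMatrix : ∀ k → Matrix (suc k)
    fenceMatrix k = encode (λ i j → Zigzag (toℕ i) (toℕ j))

    fenceMatrix-spec : ∀ k i j → Entry (fenceMatrix k) i j ⟺ Zigzag (toℕ i) (toℕ j)
    fenceMatrix-spec k = encode-spec {suc k} (λ i j → Zigzag (toℕ i) (toℕ j))

  fence : ℕ → PointedCode
  fence k = pointed zero (fenceMatrix k)

  module Fence (k : ℕ) where
    open PointedCode (fence k)

    spec : ∀ i j → Entry matrix i j ⟺ Zigzag (toℕ i) (toℕ j)
    spec = fenceMatrix-spec k

    climb : ∀ d i j → d + toℕ i ≡ toℕ j → Reach (Entry matrix) d i j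
    climb zero i j e = toℕ-injective e
    climb (suc d) i j e = fromℕ< i<n ,
      Sum.map (proj₂ (spec _ _)) (proj₂ (spec _ _)) (zigzag-adj (sym (toℕ-fromℕ< i<n))) ,
      climb d _ j (trans (cong (d +_) (toℕ-fromℕ< i<n)) (trans (+-suc d (toℕ i)) e))
      where
      i<n : suc (toℕ i) < suc k
      i<n = ≤-trans (s≤s (≤-trans (s≤s (m≤n+m (toℕ i) d)) (≤-reflexive e))) (toℕ<n j)

    reach : ∀ i j → Reach (Entry matrix) k i j
    reach i j with ≤-total (toℕ i) (toℕ j)
    ... | inj₁ l = reach-mono (λ {x} → proj₂ (spec x x) (inj₁ refl))
      (≤-trans (m∸n≤m (toℕ j) (toℕ i)) (≤-pred (toℕ<n j)))
      (climb _ i j (m∸n+n≡m l))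
    ... | inj₂ l = reach-sym (reach-mono (λ {x} → proj₂ (spec x x) (inj₁ refl))
      (≤-trans (m∸n≤m (toℕ i) (toℕ j)) (≤-pred (toℕ<n i)))
      (climb _ j i (m∸n+n≡m l)))

    good : Good (just (fence k))
    good = pullback-isBP toℕ spec zigzag-isBP , (λ i j → k , reach i j) ,
      λ r s → toℕ-injective (zigzag-antisym (proj₁ (spec _ _) r) (proj₁ (spec _ _) s))

  -- Reachability formulas and non-tabularity

  module Reachability (F : Frame) (V : Valuation F) where

    within-holds : ∀ n {w} a → Holds F V w (within n a) ⟺ ∃ λ v → Reach (Frame.Rel F) n w v × Holds F V v a
    within-holds zero a = (λ h → _ , refl , h) , λ { (_ , refl , h) → h }
    within-holds (suc n) {w} a = to , from
      where
      to : Holds F V w (within (suc n) a) → ∃ λ v → Reach (Frame.Rel F) (suc n) w v × Holds F V v a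
      to h with ∨-elim h
      ... | inj₁ d = let u , r , t = ◇-elim d ; v , s , t' = proj₁ (within-holds n a) t
                     in v , (u , inj₁ r , s) , t'
      ... | inj₂ d = let u , r , t = ◇-elim d ; v , s , t' = proj₁ (within-holds n a) t
                     in v , (u , inj₂ r , s) , t'
      from : (∃ λ v → Reach (Frame.Rel F) (suc n) w v × Holds F V v a) → Holds F V w (within (suc n) a)
      from (v , (u , inj₁ r , s) , t) = ∨-intro (inj₁ (◇-intro u r (proj₂ (within-holds n a) (v , s , t))))
      from (v , (u , inj₂ r , s) , t) = ∨-intro (inj₂ (◇-intro u r (proj₂ (within-holds n a) (v , s , t))))

    noneBelow-elim : ∀ {i j w} → i < j → Holds F V w (noneBelow j) → ¬ Holds F V w (var i)
    noneBelow-elim {i} {suc j} (s≤s l) h with m≤n⇒m<n∨m≡n l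
    ... | inj₁ l' = noneBelow-elim l' (proj₂ (∧-elim h))
    ... | inj₂ refl = proj₁ (∧-elim h)

    noneBelow-intro : ∀ {j w} → (∀ i → i < j → ¬ Holds F V w (var i)) → Holds F V w (noneBelow j)
    noneBelow-intro {zero} h = λ x → x
    noneBelow-intro {suc j} h =
      ∧-intro (h j ≤-refl) (noneBelow-intro λ i l → h i (m<n⇒m<1+n l))

    exceeds-elim : ∀ {r m w} → Holds F V w (exceeds r m) →
      ∀ i → i < m → ∃ λ v → Holds F V v (var i ∧' noneBelow i)
    exceeds-elim {r} {suc m} h i (s≤s l) with m≤n⇒m<n∨m≡n l
    ... | inj₁ l' = exceeds-elim {r} {m} (proj₁ (∧-elim h)) i l'
    ... | inj₂ refl = let v , _ , t = proj₁ (within-holds r (var i ∧' noneBelow i)) (proj₂ (∧-elim h)) in v , t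

    exceeds-intro : ∀ {r m w} →
      (∀ i → i < m → ∃ λ v → Reach (Frame.Rel F) r w v × Holds F V v (var i ∧' noneBelow i)) →
      Holds F V w (exceeds r m)
    exceeds-intro {r} {zero} h = λ x → x
    exceeds-intro {r} {suc m} h = ∧-intro (exceeds-intro {r} {m} λ i l → h i (m<n⇒m<1+n l))
      (proj₂ (within-holds r (var m ∧' noneBelow m)) (h m ≤-refl))

  -- Two of the `size + 1` witnesses coincide, but the later one excludes the variable that marks
  -- the earlier one.
  finite-refutes-exceeds : ∀ F r → LogF F (¬' (exceeds r (suc (FinFrame.size F))))
  finite-refutes-exceeds F r = Log⇒LogF F (¬' (exceeds r (suc (FinFrame.size F)))) λ V w h →
    let open Reachability (toFrame F) V
        e = exceeds-elim {r} {suc (FinFrame.size F)} {w} h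
        v = λ (i : Fin (suc (FinFrame.size F))) → proj₁ (e (toℕ i) (toℕ<n i))
        i , j , i<j , v≡v' = pigeonhole ≤-refl v
        t = λ i → ∧-elim (proj₂ (e (toℕ i) (toℕ<n i)))
    in noneBelow-elim {toℕ i} {toℕ j} {v j} i<j (proj₂ (t j)) (subst (λ u → V (toℕ i) u ≡ true) v≡v' (proj₁ (t i)))

  -- Making `var i` true at `e i` alone satisfies in `F` the counting formula that a finite frame of
  -- the given size refutes.
  infinite⇒¬tabular : ∀ F (e : ℕ → Frame.World F) → (∀ {i j} → e i ≡ e j → i ≡ j) →
    (∀ m → ∃ λ r → ∃ λ w → ∀ i → i < m → Reach (Frame.Rel F) r w (e i)) → ¬ Tabular (Log F)
  infinite⇒¬tabular F e inj near (G , _ , sup) with near (suc (FinFrame.size G))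
  ... | r , w , h = sup (¬' (exceeds r m)) (finite-refutes-exceeds G r) V w
    (exceeds-intro {r} {m} λ i l → e i , h i l , ∧-intro (truth⁺ refl)
      (noneBelow-intro λ j j<i t → <-irrefl (sym (inj (truth⁻ t))) j<i))
    where
    m = suc (FinFrame.size G)
    V : Valuation F
    V i v = truth (v ≡ e i)
    open Reachability F V

  indexLogic-¬tabular : ∀ i → Good i → ¬ Tabular (indexLogic i)
  indexLogic-¬tabular nothing _ = infinite⇒¬tabular _ (λ i → i) (λ e → e)
    λ m → m , 0 , λ i l → reach-mono (inj₁ refl) (<⇒≤ l)
      (subst (Reach Zigzag i 0) (+-identityʳ i) (zigzag-reach i 0))
  indexLogic-¬tabular (just c) (bp , _) = infinite⇒¬tabular _ inj₂ (λ { refl → refl })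
    λ m → 1 , inj₂ 0 , λ i l → _ , inj₁ (IsBP.R-refl bp) , refl

  -- The canonical model

  module Canonical (L : Logic) (ntl : IsNTL L) where
    open IsNTL ntl

    private
      three : Fm → Fm → Fm → ℕ → Fm
      three a b c zero = a
      three a b c (suc zero) = b
      three a b c (suc (suc _)) = c

    axK : ∀ {a b} → L (a ⇒ b ⇒ a)
    axK {a} {b} = sub (three a b b) ax1

    axS : ∀ {a b c} → L ((a ⇒ b ⇒ c) ⇒ (a ⇒ b) ⇒ a ⇒ c)
    axS {a} {b} {c} = sub (three a b c) ax2

    axDN : ∀ {a} → L (¬' (¬' a) ⇒ a)
    axDN {a} = sub (three a a a) ax3

    record Theory (T : Fm → Set) : Set where
      field
        base : ∀ {a} → L a → T a
        detach : ∀ {a b} → T (a ⇒ b) → T a → T b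

    module _ {T : Fm → Set} (th : Theory T) where
      open Theory th

      weaken : ∀ {a b} → T b → T (a ⇒ b)
      weaken = detach (base axK)

      distribute : ∀ {a b c} → T (a ⇒ b ⇒ c) → T (a ⇒ b) → T (a ⇒ c)
      distribute f g = detach (detach (base axS) f) g

      identity : ∀ {a} → T (a ⇒ a)
      identity {a} = distribute {a} {a ⇒ a} (base axK) (base axK)

      extension : ∀ a → Theory (λ b → T (a ⇒ b))
      extension a = record { base = λ h → weaken (base h) ; detach = distribute }

    L-theory : Theory L
    L-theory = record { base = λ h → h ; detach = mp }

    L-¬¬-intro : ∀ {a} → L (a ⇒ ¬' (¬' a))
    L-¬¬-intro {a} = distribute (extension L-theory a)
      (weaken L-theory (identity L-theory)) axK

    record IsMCS (f : Fm → Bool) : Set where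
      field
        theory : Theory (λ a → f a ≡ true)
        consistent : ¬ f ⊥' ≡ true
        decides : ∀ a → f a ≡ true ⊎ f (¬' a) ≡ true

    MCS : Set
    MCS = Σ (Fm → Bool) IsMCS

    _∋_ : MCS → Fm → Set
    w ∋ a = proj₁ w a ≡ true

    module Lindenbaum {T : Fm → Set} (th : Theory T) (con : ¬ T ⊥') where

      -- Adding `a` means passing to what follows from the hypothesis `a`; consistency of the result
      -- is literally the test that failed.
      grow : (S : Fm → Set) (a : Fm) → S (a ⇒ ⊥') ⊎ ¬ S (a ⇒ ⊥') → Fm → Set
      grow S a (inj₁ _) = S
      grow S a (inj₂ _) = λ b → S (a ⇒ b)

      stage : ℕ → Fm → Set
      stage zero = T
      stage (suc n) = grow (stage n) (enumFm n) (em (stage n (enumFm n ⇒ ⊥')))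

      stage-theory : ∀ n → Theory (stage n)
      stage-theory zero = th
      stage-theory (suc n) with em (stage n (enumFm n ⇒ ⊥'))
      ... | inj₁ _ = stage-theory n
      ... | inj₂ _ = extension (stage-theory n) (enumFm n)

      stage-consistent : ∀ n → ¬ stage n ⊥'
      stage-consistent zero = con
      stage-consistent (suc n) with em (stage n (enumFm n ⇒ ⊥'))
      ... | inj₁ _ = stage-consistent n
      ... | inj₂ c = c

      stage-suc : ∀ n {a} → stage n a → stage (suc n) a
      stage-suc n h with em (stage n (enumFm n ⇒ ⊥'))
      ... | inj₁ _ = h
      ... | inj₂ _ = weaken (stage-theory n) h

      stage-mono : ∀ {m n a} → m ≤′ n → stage m a → stage n a
      stage-mono ≤′-refl h = h
      stage-mono {m} {suc n} {a} (≤′-step l) h = stage-suc n (stage-mono {m} {n} {a} l h)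

      stage-decides : ∀ n → stage (suc n) (enumFm n) ⊎ stage n (¬' (enumFm n))
      stage-decides n with em (stage n (enumFm n ⇒ ⊥'))
      ... | inj₁ h = inj₂ h
      ... | inj₂ _ = inj₁ (identity (stage-theory n))

      limit : Fm → Set
      limit a = ∃ λ n → stage n a

      limit-decides : ∀ a → limit a ⊎ limit (¬' a)
      limit-decides a with enumFm-surjective a
      ... | n , refl = Sum.map (suc n ,_) (n ,_) (stage-decides n)

      limit-theory : Theory limit
      limit-theory = record
        { base = λ h → 0 , Theory.base th h
        ; detach = λ (m , f) (n , x) → m ⊔ n ,
            Theory.detach (stage-theory (m ⊔ n)) (stage-mono (≤⇒≤′ (m≤m⊔n m n)) f) (stage-mono (≤⇒≤′ (m≤n⊔m m n)) x) }

      world : MCS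
      world = (λ a → truth (limit a)) , record
        { theory = record
          { base = λ h → truth⁺ (Theory.base limit-theory h)
          ; detach = λ f x → truth⁺ (Theory.detach limit-theory (truth⁻ f) (truth⁻ x)) }
        ; consistent = λ h → let n , c = truth⁻ h in stage-consistent n c
        ; decides = λ a → Sum.map truth⁺ truth⁺ (limit-decides a) }

      world∋ : ∀ {a} → T a → world ∋ a
      world∋ h = truth⁺ (0 , h)

    module _ (w : MCS) where
      open IsMCS (proj₂ w)
      open Theory theory

      ∋-mp : ∀ {a b} → w ∋ (a ⇒ b) → w ∋ a → w ∋ b
      ∋-mp = detach

      ∋-L : ∀ {a b} → L (a ⇒ b) → w ∋ a → w ∋ b
      ∋-L h = detach (base h)

      ∋-¬ : ∀ {a} → w ∋ ¬' a → ¬ w ∋ a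
      ∋-¬ h k = consistent (detach h k)

      ∌⇒∋¬ : ∀ {a} → ¬ w ∋ a → w ∋ ¬' a
      ∌⇒∋¬ {a} h with decides a
      ... | inj₁ k = ⊥-elim (h k)
      ... | inj₂ k = k

      ∋-⇒ : ∀ {a b} → (w ∋ a → w ∋ b) → w ∋ (a ⇒ b)
      ∋-⇒ {a} {b} f with decides a
      ... | inj₁ k = weaken theory (f k)
      ... | inj₂ k = distribute theory (weaken theory (base axDN))
                       (distribute theory (weaken theory (base axK)) k)

    _⟶_ : MCS → MCS → Set
    w ⟶ v = ∀ a → w ∋ □ a → v ∋ a

    -- If `a` failed at `w`, then `conv□` would put `𝖯 (¬' a)` into `v`. This unfolds to the
    -- negation of `■ (¬' (¬' a))`, which follows from `■ a`.
    ⟶⇒■ : ∀ {w v} → w ⟶ v → ∀ a → v ∋ ■ a → w ∋ a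
    ⟶⇒■ {w} {v} r a h = dne λ n →
      ∋-¬ v (r _ (∋-L w (sub (λ _ → ¬' a) conv□) (∌⇒∋¬ w n)))
        (∋-L v (mp (sub (three a (¬' (¬' a)) a) K■) (nec■ L-¬¬-intro)) h)

    ■⇒⟶ : ∀ {w v} → (∀ a → v ∋ ■ a → w ∋ a) → w ⟶ v
    ■⇒⟶ {w} {v} r a h = dne λ n →
      ∋-¬ w (r _ (∋-L v (sub (λ _ → ¬' a) conv■) (∌⇒∋¬ v n)))
        (∋-L w (mp (sub (three a (¬' (¬' a)) a) K□) (nec□ L-¬¬-intro)) h)

    unbox□ : ∀ w → Theory (λ b → w ∋ □ b)
    unbox□ w = record
      { base = λ h → Theory.base (IsMCS.theory (proj₂ w)) (nec□ h)
      ; detach = λ {a} {b} f x → ∋-mp w (∋-L w (sub (three a b b) K□) f) x }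

    unbox■ : ∀ w → Theory (λ b → w ∋ ■ b)
    unbox■ w = record
      { base = λ h → Theory.base (IsMCS.theory (proj₂ w)) (nec■ h)
      ; detach = λ {a} {b} f x → ∋-mp w (∋-L w (sub (three a b b) K■) f) x }

    canonicalFrame : Frame
    canonicalFrame = frame _⟶_

    canonicalValuation : Valuation canonicalFrame
    canonicalValuation i w = proj₁ w (var i)

    truth-lemma : ∀ a w → Holds canonicalFrame canonicalValuation w a ⟺ w ∋ a
    truth-lemma (var i) w = (λ h → h) , λ h → h
    truth-lemma ⊥' w = ⊥-elim , IsMCS.consistent (proj₂ w)
    truth-lemma (a ⇒ b) w =
      (λ f → ∋-⇒ w λ x → proj₁ (truth-lemma b w) (f (proj₂ (truth-lemma a w) x))) ,
      (λ f x → proj₂ (truth-lemma b w) (∋-mp w f (proj₁ (truth-lemma a w) x)))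
    truth-lemma (□ a) w =
      (λ h → dne λ n →
        -- A world containing `¬' a` and all that `w` boxes; it exists because inconsistency would
        -- put `□ a` into `w`.
        let open Lindenbaum (extension (unbox□ w) (¬' a))
                   (λ c → n (Theory.detach (unbox□ w) (Theory.base (unbox□ w) axDN) c))
        in ∋-¬ world (world∋ (identity (unbox□ w)))
             (proj₁ (truth-lemma a world) (h world (λ b k → world∋ (weaken (unbox□ w) k))))) ,
      (λ h v r → proj₂ (truth-lemma a v) (r a h))
    truth-lemma (■ a) w =
      (λ h → dne λ n →
        let open Lindenbaum (extension (unbox■ w) (¬' a))
                   (λ c → n (Theory.detach (unbox■ w) (Theory.base (unbox■ w) axDN) c))
        in ∋-¬ world (world∋ (identity (unbox■ w)))
             (proj₁ (truth-lemma a world)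
               (h world (■⇒⟶ {world} {w} (λ b k → world∋ (weaken (unbox■ w) k)))))) ,
      (λ h v r → proj₂ (truth-lemma a v) (⟶⇒■ {v} {w} r a h))

    canonicalModel : CanonicalModel L
    canonicalModel = record
      { F = canonicalFrame
      ; V = canonicalValuation
      ; valid = λ {a} h w → proj₂ (truth-lemma a w) (Theory.base (IsMCS.theory (proj₂ w)) h)
      ; complete = λ {a} h → dne λ n →
          let open Lindenbaum (extension L-theory (¬' a)) (λ c → n (mp axDN c))
          in ∋-¬ world (world∋ (identity L-theory)) (proj₁ (truth-lemma a world) (h world))
      ; tight = λ {w} {v} h a k → proj₁ (truth-lemma a v) (h a (proj₂ (truth-lemma (□ a) w) k)) }

  module _ {F : Frame} {V : Valuation F} where
    ⋀-holds : ∀ {n w} (a : Fin n → Fm) → Holds F V w (⋀ a) ⟺ (∀ i → Holds F V w (a i))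
    ⋀-holds {zero} a = (λ _ ()) , λ _ x → x
    ⋀-holds {suc n} a =
      (λ { h zero → proj₁ (∧-elim h) ; h (suc i) → proj₁ (⋀-holds (λ i → a (suc i))) (proj₂ (∧-elim h)) i }) ,
      (λ h → ∧-intro (h zero) (proj₂ (⋀-holds (λ i → a (suc i))) (λ i → h (suc i))))

    unless-intro : ∀ {A : Set} {w a} (d : Dec A) → (¬ A → Holds F V w a) → Holds F V w (unless d a)
    unless-intro (yes _) h = λ x → x
    unless-intro (no n) h = h n

    unless-elim : ∀ {A : Set} {w a} (d : Dec A) → ¬ A → Holds F V w (unless d a) → Holds F V w a
    unless-elim (yes x) n h = ⊥-elim (n x)
    unless-elim (no _) n h = h

  -- Canonicity of the depth and width axioms

  module ModelProperties {L : Logic} (ext : ExtS4BP L) (M : CanonicalModel L) where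
    open CanonicalModel M public
    open Frame F public renaming (World to W; Rel to R)
    open IsNTL (proj₁ ext)

    infix 4 _⊩_
    _⊩_ : W → Fm → Set
    w ⊩ a = Holds F V w a

    separate : ∀ {w v} → ¬ R w v → ∃ λ a → w ⊩ □ a × ¬ v ⊩ a
    separate n = let a , h = ¬∀⇒∃ (λ h → n (tight h)) in a , ¬→⇒× h

    -- If `a` separates forwards, then `◇ (¬' a)` separates backwards: failure of `a` at `v` boxes
    -- it into the past, and `□ a` at `w` refutes it.
    separate⁻ : ∀ {w v} → ¬ R w v → ∃ λ a → v ⊩ ■ a × ¬ w ⊩ a
    separate⁻ n = let a , h , k = separate n in
      ◇ (¬' a) , (λ u r → ◇-intro _ r k) , λ d → let u , r , ¬a = ◇-elim d in ¬a (h u r)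

    private
      module Width (M B : Fm → Fm) (S : W → W → Set) (S-refl : ∀ {w : W} → S w w)
                   (B-elim : ∀ {w v : W} {a : Fm} → w ⊩ B a → S w v → v ⊩ a)
                   (sep : ∀ {w v : W} → ¬ S w v → ∃ λ (a : Fm) → w ⊩ B a × ¬ v ⊩ a)
                   (M-bw : ∀ {w : W} (a : Fin 3 → Fm) →
                     (∀ (i : Fin 3) → ∃ λ (v : W) → S w v × v ⊩ a i) →
                     ∃ λ (i : Fin 3) → ∃ λ (j : Fin 3) → i ≢ j × ∃ λ (v : W) → S w v × v ⊩ a i ×
                       (v ⊩ a j ⊎ ∃ λ (u : W) → S v u × u ⊩ a j)) where

        -- If no two were related, the conjunction `A i` would describe `y i` against the others.
        -- The axiom yields `v` with `A i` that satisfies `A j` or sees such a point, and there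
        -- `a i j` is both forced by `v` and denied by `A j`.
        width : Width≤2 S
        width {x} y h = dne contradictory
          where
          contradictory : ¬ ¬ (∃ λ i → ∃ λ j → i ≢ j × S (y i) (y j))
          contradictory none = clash (M-bw A (λ i → y i , h i , proj₂ (⋀-holds (X i)) (X-holds i)))
            where
            a : Fin 3 → Fin 3 → Fm
            a i j with i ≟ j
            ... | yes _ = ⊤'
            ... | no n = proj₁ (sep {y i} {y j} λ s → none (i , j , n , s))
            a-spec : ∀ i j → i ≢ j → y i ⊩ B (a i j) × ¬ y j ⊩ a i j
            a-spec i j n with i ≟ j
            ... | yes e = ⊥-elim (n e)
            ... | no n = proj₂ (sep {y i} {y j} λ s → none (i , j , n , s))
            X : Fin 3 → Fin 3 → Fm
            X i j = unless (i ≟ j) (B (a i j) ∧' ¬' (a j i))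
            X-holds : ∀ i j → y i ⊩ X i j
            X-holds i j = unless-intro (i ≟ j) λ n →
              ∧-intro (proj₁ (a-spec i j n)) (proj₂ (a-spec j i λ e → n (sym e)))
            X-elim : ∀ {v} i j → i ≢ j → v ⊩ X i j → v ⊩ B (a i j) × ¬ v ⊩ a j i
            X-elim i j n t = ∧-elim (unless-elim (i ≟ j) n t)
            A : Fin 3 → Fm
            A i = ⋀ (X i)
            A-elim : ∀ {v} i j → i ≢ j → v ⊩ A i → v ⊩ B (a i j) × ¬ v ⊩ a j i
            A-elim i j n t = X-elim i j n (proj₁ (⋀-holds (X i)) t j)
            clash : (∃ λ i → ∃ λ j → i ≢ j × ∃ λ v → S x v × v ⊩ A i × (v ⊩ A j ⊎ ∃ λ u → S v u × u ⊩ A j)) → ⊥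
            clash (i , j , n , v , s , t , inj₁ t') =
              proj₂ (A-elim j i (λ e → n (sym e)) t') (B-elim (proj₁ (A-elim i j n t)) S-refl)
            clash (i , j , n , v , s , t , inj₂ (u , s' , t')) =
              proj₂ (A-elim j i (λ e → n (sym e)) t') (B-elim (proj₁ (A-elim i j n t)) s')

      substitution : (Fin 3 → Fm) → ℕ → Fm
      substitution a zero = a zero
      substitution a (suc zero) = a (suc zero)
      substitution a (suc (suc _)) = a (suc (suc zero))

    R-isBP : IsBP R
    R-isBP = record
      { R-refl = R-refl
      ; R-trans = λ r s → tight λ a h → valid (sub (λ _ → a) four) _ h _ r _ s
      ; depth = depth
      ; width⁺ = Width.width ◇ □ R R-refl (λ h r → h _ r) separate
          (λ {w} a → proj₁ (Forward.bw-holds {w} {a}) (valid (sub (substitution a) bw⁺) w))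
      ; width⁻ = Width.width 𝖯 ■ (flip R) R-refl (λ h r → h _ r) separate⁻
          (λ {w} a → proj₁ (Backward.bw-holds {w} {a}) (valid (sub (substitution a) bw⁻) w)) }
      where
      open Semantics F V
      T = proj₁ (proj₂ ext)
      four = proj₁ (proj₂ (proj₂ ext))
      bd = proj₁ (proj₂ (proj₂ (proj₂ ext)))
      bw⁺ = proj₁ (proj₂ (proj₂ (proj₂ (proj₂ ext))))
      bw⁻ = proj₂ (proj₂ (proj₂ (proj₂ (proj₂ ext))))
      R-refl : ∀ {x} → R x x
      R-refl = tight λ a h → valid (sub (λ _ → a) T) _ h
      depth : Depth≤2 R
      depth {x} {y} {z} r s with em (R y x) | em (R z y)
      ... | inj₁ t | _ = inj₁ t
      ... | _ | inj₁ t = inj₂ t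
      ... | inj₂ n | inj₂ n' with separate n | separate n'
      -- `b` separates `y` from `x` and `a` separates `z` from `y`: the instance of `bd2` for `a`
      -- and `b` then forces `b` at `x`.
      ... | b , □b , ¬b | a , □a , ¬a = ⊥-elim (¬b (valid (sub (λ { zero → a ; (suc _) → b }) bd) x
        (◇-intro y r (∧-intro □b λ f → ¬a (f (◇-intro z s □a))))))

  -- Transversals and unions of coded frames

  -- Greedy choice: a scattered family that cannot be extended meets every class.
  scattered-or-transversal : ∀ {W : Set} (E : W → W → Set) (P : W → Set) → (∀ {x y} → E x y → E y x) →
    ∀ k → Scattered E P k ⊎ ∃ λ n → n < k × Transversal E P n
  scattered-or-transversal E P sy zero = inj₁ ((λ ()) , (λ ()) , λ ())
  scattered-or-transversal {W} E P sy (suc k) with scattered-or-transversal E P sy k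
  ... | inj₂ (n , l , t) = inj₂ (n , m<n⇒m<1+n l , t)
  ... | inj₁ s@(f , fP , fE) with em (∃ λ w → P w × ∀ i → ¬ E (f i) w)
  ... | inj₂ n = inj₂ (k , n<1+n k , s , λ w p → dne λ h → n (w , p , λ i e → h (i , e)))
  ... | inj₁ (w , p , h) = inj₁ (g , gP , gE)
    where
    g : Fin (suc k) → W
    g zero = w
    g (suc i) = f i
    gP : ∀ i → P (g i)
    gP zero = p
    gP (suc i) = fP i
    gE : ∀ i j → i ≢ j → ¬ E (g i) (g j)
    gE zero zero n _ = n refl
    gE zero (suc j) n e = h j (sy e)
    gE (suc i) zero n e = h i e
    gE (suc i) (suc j) n e = fE i j (λ x → n (cong suc x)) e

  transversal : ∀ {W : Set} {E : W → W → Set} {P : W → Set} →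
    (∀ {x y} → E x y → E y x) → (∀ {x y z} → E x y → E y z → E x z) →
    ∀ {l} → Covers E P l → ∃ λ n → n ≤ length l × Transversal E P n
  transversal {E = E} {P} sy tr {l} c with scattered-or-transversal E P sy (suc (length l))
  ... | inj₁ s = ⊥-elim (<-irrefl refl (scattered≤cover sy tr s c))
  ... | inj₂ (n , s≤s h , t) = n , h , t

  union-of-codes : (keep : Code → Set) (l : List Code) →
    Σ FinFrame λ U → ∀ a → Log (toFrame U) a ⟺ (∀ c → c ∈ l → keep c → Log (toFrame (codeFrame c)) a)
  union-of-codes keep [] = record { size = 0 ; R = λ () } , λ a → (λ _ _ ()) , λ _ V ()
  union-of-codes keep (c ∷ l) with union-of-codes keep l | em (keep c)
  ... | U , h | inj₂ n = U , λ a →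
    (λ { x .c (here refl) k → ⊥-elim (n k) ; x d (there m) k → proj₁ (h a) x d m k }) ,
    (λ x → proj₂ (h a) λ d m → x d (there m))
  ... | U , h | inj₁ k = union , λ a →
    (λ { x .c (here refl) _ → proj₁ (proj₁ (Log-union a) x)
       ; x d (there m) k → proj₁ (h a) (proj₂ (proj₁ (Log-union a) x)) d m k }) ,
    (λ x → proj₂ (Log-union a) (x c (here refl) k , proj₂ (h a) λ d m → x d (there m)))
    where open Union (codeFrame c) U

  -- Definable maps

  module DefinableMaps (F : Frame) (V : Valuation F) where
    open Frame F renaming (World to W)

    -- Tests by Boolean functions are what pulling back a valuation requires: each test is the truth
    -- value of an atom.
    Definable : ∀ {A : Set} → (W → A) → Set
    Definable {A} τ = ∀ (b : A → Bool) → ∃ λ χ → ∀ w → Holds F V w χ ⟺ (b (τ w) ≡ true)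

    definable-const : ∀ {A : Set} (x : A) → Definable (λ _ → x)
    definable-const x b with b x
    ... | true = ⊤' , λ w → (λ _ → refl) , λ _ h → h
    ... | false = ⊥' , λ w → (λ ()) , λ ()

    definable-∘ : ∀ {A B : Set} (f : A → B) {τ : W → A} → Definable τ → Definable (λ w → f (τ w))
    definable-∘ f d b = d (λ x → b (f x))

    definable-if : ∀ {A : Set} δ {σ τ : W → A} → Definable σ → Definable τ →
      Definable (λ w → if truth (Holds F V w δ) then σ w else τ w)
    definable-if {A} δ {σ} {τ} d e b = (δ ⇒ χ) ∧' (¬' δ ⇒ ψ) , spec
      where
      χ = proj₁ (d b)
      ψ = proj₁ (e b)
      spec : ∀ w → Holds F V w ((δ ⇒ χ) ∧' (¬' δ ⇒ ψ)) ⟺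
        (b (if truth (Holds F V w δ) then σ w else τ w) ≡ true)
      spec w with em (Holds F V w δ)
      ... | inj₁ h = (λ c → proj₁ (proj₂ (d b) w) (proj₁ (∧-elim c) h)) ,
                     (λ t → ∧-intro (λ _ → proj₂ (proj₂ (d b) w) t) (λ n → ⊥-elim (n h)))
      ... | inj₂ n = (λ c → proj₁ (proj₂ (e b) w) (proj₂ (∧-elim c) n)) ,
                     (λ t → ∧-intro (λ h → ⊥-elim (n h)) (λ _ → proj₂ (proj₂ (e b) w) t))

    Separates : Fm → (W → Set) → (W → Set) → Set
    Separates a P Q = (∀ w → P w → Holds F V w a) × (∀ w → Q w → ¬ Holds F V w a)

    -- Class 0 is split off by the conjunction of the formulas separating it from the others;
    -- outside the classes the value is arbitrary.
    classifier : ∀ {n} (X : Fin (suc n) → W → Set) →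
      (∀ i j → i ≢ j → ∃ λ a → Separates a (X i) (X j)) →
      ∃ λ τ → Definable τ × (∀ i w → X i w → τ w ≡ i)
    classifier {zero} X s = (λ _ → zero) , definable-const zero , λ { zero w _ → refl }
    classifier {suc n} X s with classifier (λ i → X (suc i)) (λ i j n → s _ _ λ { refl → n refl })
    ... | τ , d , h = (λ w → if truth (Holds F V w δ) then zero else suc (τ w)) ,
      definable-if δ (definable-const zero) (definable-∘ suc d) , spec
      where
      a = λ j → s zero (suc j) (λ ())
      δ = ⋀ (λ j → proj₁ (a j))
      spec : ∀ i w → X i w → (if truth (Holds F V w δ) then zero else suc (τ w)) ≡ i
      spec zero w x with em (Holds F V w δ)
      ... | inj₁ _ = refl
      ... | inj₂ n = ⊥-elim (n (proj₂ (⋀-holds (λ j → proj₁ (a j))) λ j → proj₁ (proj₂ (a j)) w x))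
      spec (suc i) w x with em (Holds F V w δ)
      ... | inj₁ t = ⊥-elim (proj₂ (proj₂ (a i)) w x (proj₁ (⋀-holds (λ j → proj₁ (a j))) t i))
      ... | inj₂ _ = cong suc (h i w x)

    classifier′ : ∀ {n} → Fin n → (X : Fin n → W → Set) →
      (∀ i j → i ≢ j → ∃ λ a → Separates a (X i) (X j)) →
      ∃ λ τ → Definable τ × (∀ i w → X i w → τ w ≡ i)
    classifier′ {suc n} _ = classifier

  refutation : ∀ {L F} → ¬ (L ⊆L Log F) → ∃ λ a → L a × ∃ λ V → ∃ λ w → ¬ Holds F V w a
  refutation n =
    let a , h = ¬∀⇒∃ n ; l , h = ¬→⇒× h ; V , h = ¬∀⇒∃ h ; w , h = ¬∀⇒∃ h in a , l , V , w , h

  -- Folding a long path of the canonical model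

  module PathBound {L : Logic} (ext : ExtS4BP L) (M : CanonicalModel L) where
    open ModelProperties ext M
    open IsNTL (proj₁ ext) using (sub)
    open IsBP R-isBP
    open Local R-isBP
    open DefinableMaps F V

    infix 4 _~_
    _~_ : W → W → Set
    _~_ = Cluster R

    -- A formula separating two worlds is boxed, and negated if necessary, because boxed formulas
    -- are constant on clusters.
    cluster-separated : ∀ {x y} → ¬ x ~ y → ∃ λ a → Separates a (x ~_) (y ~_)
    cluster-separated {x} {y} n with em (R x y)
    ... | inj₂ n' = let a , h , k = separate n' in
      □ a , (λ w (r , _) v s → h v (R-trans r s)) , λ w (r , s) t → k (t y s)
    ... | inj₁ r with separate (λ s → n (r , s))
    ... | a , h , k = ¬' (□ a) , (λ w (_ , s) t → k (t x s)) , λ w (r , s) t → t λ v u → h v (R-trans r u)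

    module FoldPath {m : ℕ} (P : Path m) (U : Valuation (frame Zigzag)) where
      open Path P

      up : Bool → ℕ → Set
      up true i = R (z i) (z (suc i))
      up false i = R (z (suc i)) (z i)

      ≁ : ∀ {i j} → i ≢ j → i ≤ m → j ≤ m → ¬ z i ~ z j
      ≁ n l l' c = n (distinct l l' c)

      module At (i : ℕ) (l : suc (suc i) ≤ m) where
        i+1≤m = <⇒≤ l
        i≤m = <⇒≤ i+1≤m

        y≁a : ¬ z (suc i) ~ z i
        y≁a = ≁ (λ ()) i+1≤m i≤m
        y≁b : ¬ z (suc i) ~ z (suc (suc i))
        y≁b = ≁ (λ ()) i+1≤m l
        a≁b : ¬ z i ~ z (suc (suc i))
        a≁b = ≁ (λ ()) i≤m l

        module Below = Fork y≁a y≁b a≁b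
        module Above = Local.Fork (flip-isBP R-isBP)
          (λ c → y≁a (cluster-sym c)) (λ c → y≁b (cluster-sym c)) (λ c → a≁b (cluster-sym c))

        -- The two neighbours of an inner point lie in different clusters, hence both above or both
        -- below it.
        turn : ∀ b → up b i → up (not b) (suc i)
        turn true r = Above.other-prong r (swap (adjacent (suc i) l))
        turn false r = Below.other-prong r (adjacent (suc i) l)

      ups : ∃ λ b → ∀ i → i < m → up (alternate b i) i
      ups with em (up true 0)
      ... | inj₁ r = true , go true r
        where
        go : ∀ b → up b 0 → ∀ i → i < m → up (alternate b i) i
        go b r zero l = r
        go b r (suc i) l = subst (λ c → up c (suc i)) (sym (alternate-not b i)) (At.turn i l (alternate b i) (go b r i (<⇒≤ l)))
      ... | inj₂ n = false , go
        where
        go : ∀ i → i < m → up (alternate false i) i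
        go zero l = [ (λ r → ⊥-elim (n r)) , (λ r → r) ]′ (adjacent 0 l)
        go (suc i) l = subst (λ c → up c (suc i)) (sym (alternate-not false i)) (At.turn i l (alternate false i) (go i (<⇒≤ l)))

      b₀ = proj₁ ups

      module Centred (s : ℕ) (s-even : alternate b₀ s ≡ true) where

        fold : ℕ → ℕ
        fold j = ∣ s - j ∣

        -- The position stays more than `n` steps from both ends: an end may have neighbours off the
        -- path, which have no image.
        data Z (n : ℕ) (w : W) (x : ℕ) : Set where
          at : ∀ j → n < j → n + j < m → w ~ z j → fold j ≡ x → Z n w x

        X : Fin (suc m) → W → Set
        X i w = z (toℕ i) ~ w

        abstract
          classified : ∃ λ τ → Definable τ × (∀ i w → X i w → τ w ≡ i)
          classified = classifier X λ i j n → cluster-separated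
            (≁ (λ e → n (toℕ-injective e)) (≤-pred (toℕ<n i)) (≤-pred (toℕ<n j)))

        τ : W → Fin (suc m)
        τ = proj₁ classified

        atoms : ∀ i → ∃ λ χ → ∀ w → w ⊩ χ ⟺ (U i (fold (toℕ (τ w))) ≡ true)
        atoms i = proj₁ (proj₂ classified) (λ t → U i (fold (toℕ t)))

        σ : ℕ → Fm
        σ i = proj₁ (atoms i)

        τ-at : ∀ {w j} → j < suc m → w ~ z j → toℕ (τ w) ≡ j
        τ-at {w} {j} l c = trans (cong toℕ (proj₂ (proj₂ classified) (fromℕ< l) w
          (subst (λ k → z k ~ w) (sym (toℕ-fromℕ< l)) (cluster-sym c)))) (toℕ-fromℕ< l)

        atom : ∀ {n w x} → Z n w x → ∀ i → w ⊩ σ i ⟺ (U i x ≡ true)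
        atom {n} {w} (at j _ l c refl) i = subst (λ k → w ⊩ σ i ⟺ (U i (fold k) ≡ true))
          (τ-at (m<n⇒m<1+n (≤-<-trans (m≤n+m j n) l)) c) (proj₂ (atoms i) w)

        module Around {n w j} (l : suc n < suc j) (l' : suc n + suc j < m) (c : w ~ z (suc j)) where
          j+2≤m : suc (suc j) ≤ m
          j+2≤m = <-≤-trans (s≤s (m≤n+m (suc j) (suc n))) l'
          open At j j+2≤m

          stay : ∀ {w'} → w' ~ z (suc j) → Z n w' (fold (suc j))
          stay c' = at (suc j) (<-trans (n<1+n n) l) (<-trans (n<1+n _) l') c' refl

          retreat : ∀ {w'} → w' ~ z j → Z n w' (fold j)
          retreat c' = at j (≤-pred l) (<-trans (subst (n + j <_) (cong suc (sym (+-suc n j))) (m<n⇒m<1+n (n<1+n _))) l') c' refl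

          advance : ∀ {w'} → w' ~ z (suc (suc j)) → Z n w' (fold (suc (suc j)))
          advance c' = at (suc (suc j)) (m<n⇒m<1+n (<-trans (n<1+n n) l)) (subst (_< m) (sym (+-suc n (suc j))) l') c' refl

          up-j : up (alternate b₀ j) j
          up-j = proj₂ ups j (<⇒≤ j+2≤m)

          up-j+1 : up (not (alternate b₀ j)) (suc j)
          up-j+1 = At.turn j j+2≤m (alternate b₀ j) up-j

          -- On its interior the path is folded so that its lower points go to even numbers.
          e₋ : even (fold j) ≡ alternate b₀ j
          e₋ = even-distance b₀ s j s-even

          e₀ : even (fold (suc j)) ≡ not (alternate b₀ j)
          e₀ = trans (even-distance b₀ s (suc j) s-even) (alternate-not b₀ j)

          e₊ : even (fold (suc (suc j))) ≡ alternate b₀ j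
          e₊ = trans (even-distance b₀ s (suc (suc j)) s-even) (cong (λ b → alternate b j) (not-involutive b₀))

          forth : ∀ {w'} → R w w' → ∃ λ x' → Zigzag (fold (suc j)) x' × Z n w' x'
          forth {w'} r = go (alternate b₀ j) up-j up-j+1 e₀
            where
            Goal = ∃ λ x' → Zigzag (fold (suc j)) x' × Z n w' x'
            go : ∀ b → up b j → up (not b) (suc j) → even (fold (suc j)) ≡ not b → Goal
            -- The point is maximal in this case and sees only its own cluster; in the other case it
            -- is the base of a fork.
            go true u u' e = _ , inj₁ refl ,
              stay (cluster-sym (Local.minimal (flip-isBP R-isBP) (λ c → y≁a (cluster-sym c)) u (R-trans (proj₂ c) r)))
            go false u u' e = prong (Below.prongs u u' (R-trans (proj₂ c) r))
              where
              prong : w' ~ z (suc j) ⊎ w' ~ z j ⊎ w' ~ z (suc (suc j)) → Goal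
              prong (inj₁ d) = _ , inj₁ refl , stay d
              prong (inj₂ (inj₁ d)) = _ , inj₂ (e , swap (distance-step s j)) , retreat d
              prong (inj₂ (inj₂ d)) = _ , inj₂ (e , distance-step s (suc j)) , advance d

          forth⁻ : ∀ {w'} → R w' w → ∃ λ x' → Zigzag x' (fold (suc j)) × Z n w' x'
          forth⁻ {w'} r = go (alternate b₀ j) up-j up-j+1 e₋ e₊
            where
            Goal = ∃ λ x' → Zigzag x' (fold (suc j)) × Z n w' x'
            go : ∀ b → up b j → up (not b) (suc j) → even (fold j) ≡ b → even (fold (suc (suc j))) ≡ b → Goal
            go false u u' e e' = _ , inj₁ refl , stay (minimal y≁a u (R-trans r (proj₁ c)))
            go true u u' e e' = prong (Above.prongs u u' (R-trans r (proj₁ c)))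
              where
              prong : z (suc j) ~ w' ⊎ z j ~ w' ⊎ z (suc (suc j)) ~ w' → Goal
              prong (inj₁ d) = _ , inj₁ refl , stay (cluster-sym d)
              prong (inj₂ (inj₁ d)) = _ , inj₂ (e , distance-step s j) , retreat (cluster-sym d)
              prong (inj₂ (inj₂ d)) = _ , inj₂ (e' , swap (distance-step s (suc j))) , advance (cluster-sym d)

          back : ∀ {x'} → Zigzag (fold (suc j)) x' → ∃ λ w' → R w w' × Z n w' x'
          back (inj₁ refl) = w , R-refl , stay c
          back {x'} (inj₂ (ev , st)) = go (alternate b₀ j) up-j up-j+1 e₀ (step-distance s j st)
            where
            go : ∀ b → up b j → up (not b) (suc j) → even (fold (suc j)) ≡ not b →
              x' ≡ fold j ⊎ x' ≡ fold (suc (suc j)) → ∃ λ w' → R w w' × Z n w' x'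
            go true _ _ e _ = ⊥-elim (true≢false (trans (sym ev) e))
            go false u u' e (inj₁ refl) = _ , R-trans (proj₁ c) u , retreat cluster-refl
            go false u u' e (inj₂ refl) = _ , R-trans (proj₁ c) u' , advance cluster-refl

          back⁻ : ∀ {x'} → Zigzag x' (fold (suc j)) → ∃ λ w' → R w' w × Z n w' x'
          back⁻ (inj₁ refl) = w , R-refl , stay c
          back⁻ {x'} (inj₂ (ev , st)) = go (alternate b₀ j) up-j up-j+1 e₀ (step-distance s j (swap st))
            where
            go : ∀ b → up b j → up (not b) (suc j) → even (fold (suc j)) ≡ not b →
              x' ≡ fold j ⊎ x' ≡ fold (suc (suc j)) → ∃ λ w' → R w' w × Z n w' x'
            go false _ _ e _ = ¬step-step st ev e
            go true u u' e (inj₁ refl) = _ , R-trans u (proj₂ c) , retreat cluster-refl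
            go true u u' e (inj₂ refl) = _ , R-trans u' (proj₂ c) , advance cluster-refl

        bisim : ∀ k → Bisim F (frame Zigzag) V U σ k Z
        bisim k = record
          { atom = λ t i _ → atom t i
          ; forth = λ { (at zero () _ _ _) ; (at (suc j) l l' c refl) r → Around.forth l l' c r }
          ; forth⁻ = λ { (at zero () _ _ _) ; (at (suc j) l l' c refl) r → Around.forth⁻ l l' c r }
          ; back = λ { (at zero () _ _ _) ; (at (suc j) l l' c refl) r → Around.back l l' c r }
          ; back⁻ = λ { (at zero () _ _ _) ; (at (suc j) l l' c refl) r → Around.back⁻ l l' c r } }

        -- The number `x` is met at position `s + x`, beyond the crease; the inequalities keep this
        -- position farther from both ends than the modal depth.
        zigzag-holds : ∀ {a} x → L a → modalDepth a < s → modalDepth a + (s + x) < m → Holds (frame Zigzag) U x a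
        zigzag-holds {a} x h l l' = proj₁ (Bisim.invariant (bisim (varBound a)) a ≤-refl ≤-refl
          (at (s + x) (<-≤-trans l (m≤m+n s x)) l' cluster-refl (∣m-m+n∣≡n s x))) (valid (sub σ h) (z (s + x)))

    -- The crease has to be a lower point, as 0 is in the zigzag; of two consecutive positions one
    -- is lower.
    even-start : ∀ b d → ∃ λ s → d < s × s ≤ suc (suc d) × alternate b s ≡ true
    even-start b d with alternate b (suc d) in e
    ... | true = suc d , ≤-refl , n≤1+n _ , e
    ... | false = suc (suc d) , n≤1+n _ , ≤-refl , trans (alternate-not b (suc d)) (cong not e)

    paths-bounded : ¬ (L ⊆L Log (frame Zigzag)) → ∃ λ m → ¬ Path (suc m)
    paths-bounded n with refutation n
    -- Room on the path: at most `d + 2` up to the crease, `x` more to the point, and `d` beyond it.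
    ... | a , h , U , x , f = d + (suc (suc d) + x) , λ P →
      let open FoldPath P U
          s , l , l' , e = even-start b₀ d
      in f (Centred.zigzag-holds s e x h l (s≤s (+-monoʳ-≤ d (+-monoˡ-≤ x l'))))
      where d = modalDepth a

    -- A ball still growing after radius `r` would contain a geodesic of length `r + 1`.
    radius : ¬ (L ⊆L Log (frame Zigzag)) → ∃ λ r → ∀ x n w → Ball x n w → Ball x r w
    radius n with paths-bounded n
    ... | r , none = r , go
      where
      go : ∀ x n w → Ball x n w → Ball x r w
      go x zero w b = ball-mono {x} {0} {r} z≤n b
      go x (suc n) w (v , b , a) = dne λ n' → none (geodesic {x} {suc r} ((v , go x n v b , a) , n'))

  -- Counting the clusters in a ball

  -- Of three inequivalent points strictly above `y`, width relates two, and depth merges these or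
  -- sends one back to `y`.
  strict-cover : ∀ {W : Set} {R : W → W → Set} → IsBP R → ∀ y →
    ∃ λ l → length l ≤ 2 × ∀ w → R y w → ¬ R w y → Any (λ v → Cluster R v w) l
  strict-cover {W} {R} bp y with scattered-or-transversal (Cluster R) (λ w → R y w × ¬ R w y) (λ (r , s) → s , r) 3
  ... | inj₂ (n , s≤s l , t) = let k , e , c = transversal-list t in
    k , ≤-trans (≤-reflexive e) l , λ w r n → c w (r , n)
  ... | inj₁ (f , fP , fE) = ⊥-elim (contradictory (width⁺ f (λ i → proj₁ (fP i))))
    where
    open IsBP bp
    contradictory : ¬ (∃ λ i → ∃ λ j → i ≢ j × R (f i) (f j))
    contradictory (i , j , n , r) with depth (proj₁ (fP i)) r
    ... | inj₁ s = proj₂ (fP i) s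
    ... | inj₂ s = fE i j n (r , s)

  module _ {W : Set} {R : W → W → Set} (bp : IsBP R) where
    open IsBP bp
    open Local bp

    neighbours : W → List W
    neighbours y = y ∷ proj₁ (strict-cover bp y) ++ proj₁ (strict-cover (flip-isBP bp) y)

    -- One cluster of its own, at most two above and at most two below.
    length-neighbours : ∀ y → length (neighbours y) ≤ 5
    length-neighbours y = s≤s (≤-trans (≤-reflexive (length-++ (proj₁ (strict-cover bp y))))
      (+-mono-≤ (proj₁ (proj₂ (strict-cover bp y))) (proj₁ (proj₂ (strict-cover (flip-isBP bp) y)))))

    neighbours-cover : ∀ {y w} → Adj R y w → Any (λ v → Cluster R v w) (neighbours y)
    neighbours-cover {y} {w} (inj₁ r) with em (R w y)
    ... | inj₁ s = here (r , s)
    ... | inj₂ n = there (++⁺ˡ (proj₂ (proj₂ (strict-cover bp y)) w r n))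
    neighbours-cover {y} {w} (inj₂ r) with em (R y w)
    ... | inj₁ s = here (s , r)
    ... | inj₂ n = there (++⁺ʳ (proj₁ (strict-cover bp y))
      (Any.map swap-pair (proj₂ (proj₂ (strict-cover (flip-isBP bp) y)) w r n)))
      where
      swap-pair : ∀ {v} → Cluster (flip R) v w → Cluster R v w
      swap-pair (a , b) = b , a

    ball-cover : ∀ x r → ∃ λ l → length l ≤ 5 ^ r × Covers (Cluster R) (Ball x r) l
    ball-cover x zero = x ∷ [] , ≤-refl , λ w c → here c
    ball-cover x (suc r) with ball-cover x r
    ... | l , h , c = concatMap neighbours l ,
      ≤-trans (length-concatMap length-neighbours l) (≤-trans (*-monoˡ-≤ 5 h) (≤-reflexive (*-comm (5 ^ r) 5))) ,
      covers-concatMap neighbours c λ w (v , b , a) → v , b , λ y d →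
        neighbours-cover (swap (adj-cluster (swap a) (cluster-sym d)))

  -- Logics below no member of the family are tabular

  module Tabularity {L : Logic} (ext : ExtS4BP L) (M : CanonicalModel L)
                    (notBelow : ∀ i → Good i → ¬ (L ⊆L indexLogic i)) where
    open ModelProperties ext M
    open IsNTL (proj₁ ext) using (sub)
    open IsBP R-isBP
    open Local R-isBP
    open DefinableMaps F V
    open PathBound ext M using (_~_; cluster-separated; radius)

    abstract
      rad : ℕ
      rad = proj₁ (radius (notBelow nothing tt))

      radius-spec : ∀ x n w → Ball x n w → Ball x rad w
      radius-spec = proj₂ (radius (notBelow nothing tt))

    Component : W → W → Set
    Component x = Ball x rad

    component-refl : ∀ x → Component x x
    component-refl x = radius-spec x 0 x cluster-refl

    component-adj : ∀ {x v w} → Component x v → Adj R v w → Component x w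
    component-adj {x} {v} {w} b a = radius-spec x (suc rad) w (v , b , a)

    -- Skeletons of components

    record Skeleton (x : W) {n : ℕ} (m : Matrix n) : Set where
      field
        f : Fin n → W
        relation : ∀ i j → Entry m i j ⟺ R (f i) (f j)
        inside : ∀ i → Component x (f i)
        separate-clusters : ∀ i j → i ≢ j → ¬ f i ~ f j
        covering : ∀ w → Component x w → ∃ λ i → f i ~ w

      code-isBP : IsBP (Entry m)
      code-isBP = pullback-isBP f relation R-isBP

      code-connected : Connected (Entry m)
      code-connected i j with covering x (component-refl x)
      -- All points are joined through `o`, which represents the cluster of the root.
      ... | o , c with from-root i _ (inside i) cluster-refl | from-root j _ (inside j) cluster-refl
        where
        from-root : ∀ {w} i k → Ball x k w → f i ~ w → ∃ λ n → Reach (Entry m) n o i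
        from-root i zero b d =
          1 , i , inj₁ (proj₂ (relation o i) (proj₁ (cluster-trans (cluster-trans c b) (cluster-sym d)))) , refl
        from-root i (suc k) (v , b , a) d with covering v (radius-spec x k v b)
        ... | j , e with from-root j k b e
        ... | n , p = suc n , reach-snoc {n = n} p (Sum.map (proj₂ (relation j i)) (proj₂ (relation i j))
          (adj-cluster (swap (adj-cluster (swap a) (cluster-sym e))) (cluster-sym d)))
      ... | m , p | n , q = m + n , reach-trans {m = m} (reach-sym {n = m} p) q

      code-antisym : Antisym (Entry m)
      code-antisym {i} {j} e e' = dne λ n →
        separate-clusters i j n (proj₁ (relation i j) e , proj₁ (relation j i) e')

    skeleton : ∀ x → ∃ λ n → n ≤ 5 ^ rad × ∃ λ (m : Matrix n) → Skeleton x m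
    skeleton x with ball-cover R-isBP x rad
    ... | l , h , c with transversal cluster-sym cluster-trans c
    ... | n , k , (f , fP , fE) , cov = n , ≤-trans k h , encode (λ i j → R (f i) (f j)) , record
      { f = f ; relation = encode-spec (λ i j → R (f i) (f j)) ; inside = fP
      ; separate-clusters = fE ; covering = cov }

    infix 4 _≈_
    -- Different worlds may have the same theory, so the size of a cluster is measured by theories;
    -- tightness makes `R` respect this equivalence.
    _≈_ : W → W → Set
    w ≈ v = ∀ a → w ⊩ a ⟺ v ⊩ a

    ≈-sym : ∀ {x y} → x ≈ y → y ≈ x
    ≈-sym e a = proj₂ (e a) , proj₁ (e a)

    ≈-trans : ∀ {x y z} → x ≈ y → y ≈ z → x ≈ z
    ≈-trans e e' a = (λ h → proj₁ (e' a) (proj₁ (e a) h)) , λ h → proj₂ (e a) (proj₂ (e' a) h)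

    ≈-separated : ∀ {x y} → ¬ x ≈ y → ∃ λ a → Separates a (x ≈_) (y ≈_)
    ≈-separated {x} {y} n = choose (em (x ⊩ a))
      where
      a = proj₁ (¬∀⇒∃ n)
      differ = proj₂ (¬∀⇒∃ n)
      choose : x ⊩ a ⊎ ¬ x ⊩ a → ∃ λ a → Separates a (x ≈_) (y ≈_)
      choose (inj₁ h) = a , (λ w e → proj₁ (e a) h) ,
        λ w e k → differ ((λ _ → proj₂ (e a) k) , λ _ → h)
      choose (inj₂ n') = ¬' a , (λ w e k → n' (proj₂ (e a) k)) ,
        λ w e k → differ ((λ h → ⊥-elim (n' h)) , λ h → ⊥-elim (k (proj₁ (e a) h)))

    R-≈ : ∀ {w v w' v'} → w ≈ w' → v ≈ v' → R w v → R w' v'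
    R-≈ {v = v} e e' s = tight λ a h → proj₁ (e' a) (proj₂ (e (□ a)) h v s)

    -- A large cluster over the distinguished point of a code maps onto the cluster of
    -- its blow-up, as far as the first k atoms are concerned.

    module ClusterBound (c : PointedCode) (U : Valuation (blowup c)) (k : ℕ) where
      open PointedCode c renaming (point to u)

      X = World (blowup c)
        where open Frame

      SameBits : X → X → Set
      SameBits v w = ∀ i → i < k → U i v ≡ U i w

      InCluster : X → Set
      InCluster v = collapse c v ≡ u

      abstract
        -- By pigeonhole on bit patterns, finitely many points stand for the whole infinite cluster.
        patterns : ∃ λ n → n ≤ 2 ^ k × Transversal SameBits InCluster n
        patterns with scattered-or-transversal SameBits InCluster (λ e i l → sym (e i l)) (suc (2 ^ k))
        ... | inj₂ (n , s≤s l , t) = n , l , t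
        ... | inj₁ (f , fP , fE) =
          let i , j , i<j , e = pigeonhole (n<1+n (2 ^ k)) (λ i → bits k (λ a → U a (f i)))
          in ⊥-elim (fE i j (<⇒≢ i<j) (bits-injective k e))

      N = proj₁ patterns

      t : Fin N → X
      t = proj₁ (proj₁ (proj₂ (proj₂ patterns)))

      t-cluster : ∀ j → InCluster (t j)
      t-cluster = proj₁ (proj₂ (proj₁ (proj₂ (proj₂ patterns))))

      t-cover : ∀ w → InCluster w → ∃ λ j → SameBits (t j) w
      t-cover = proj₂ (proj₂ (proj₂ patterns))

      module _ {x} (s : Skeleton x matrix) (big : Scattered _≈_ (Skeleton.f s u ~_) (2 ^ k)) where
        open Skeleton s

        abstract
          y-scattered : Scattered _≈_ (f u ~_) N
          y-scattered = scattered-mono _≈_ (f u ~_) (proj₁ (proj₂ patterns)) big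

        y : Fin N → W
        y = proj₁ y-scattered

        abstract
          τ-classified : ∃ λ (τ : W → Fin N) → Definable τ × (∀ j w → y j ≈ w → τ w ≡ j)
          τ-classified = classifier′ (proj₁ (t-cover (inj₁ u) refl)) (λ j w → y j ≈ w)
            λ i j n → ≈-separated (proj₂ (proj₂ y-scattered) i j n)

          κ-classified : ∃ λ (κ : W → Fin size) → Definable κ × (∀ i w → f i ~ w → κ w ≡ i)
          κ-classified = classifier′ u (λ i w → f i ~ w) λ i j n → cluster-separated (separate-clusters i j n)

        τ = proj₁ τ-classified
        κ = proj₁ κ-classified

        δ-definable : ∃ λ δ → ∀ w → w ⊩ δ ⟺ (does (κ w ≟ u) ≡ true)
        δ-definable = proj₁ (proj₂ κ-classified) (λ i → does (i ≟ u))

        δ = proj₁ δ-definable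

        -- A world of the large cluster equivalent to no `y j` also goes to some representative.
        -- This is harmless, since all worlds of one cluster are related alike.
        μ : W → X
        μ w = if truth (w ⊩ δ) then t (τ w) else inj₁ (κ w)

        abstract
          μ-definable : Definable μ
          μ-definable = definable-if δ (definable-∘ t (proj₁ (proj₂ τ-classified)))
                                       (definable-∘ inj₁ (proj₁ (proj₂ κ-classified)))

        μ-inside : ∀ {w} → f u ~ w → μ w ≡ t (τ w)
        μ-inside {w} d with em (w ⊩ δ)
        ... | inj₁ _ = refl
        ... | inj₂ n = ⊥-elim (n (proj₂ (proj₂ δ-definable w) at-u))
          where
          at-u : does (κ w ≟ u) ≡ true
          at-u with κ w ≟ u
          ... | yes _ = refl
          ... | no n = ⊥-elim (n (proj₂ (proj₂ κ-classified) u w d))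

        μ-outside : ∀ {i w} → i ≢ u → f i ~ w → μ w ≡ inj₁ i
        μ-outside {i} {w} n d with em (w ⊩ δ)
        ... | inj₂ _ = cong inj₁ (proj₂ (proj₂ κ-classified) i w d)
        ... | inj₁ h = ⊥-elim (not-at-u (proj₁ (proj₂ δ-definable w) h))
          where
          not-at-u : ¬ does (κ w ≟ u) ≡ true
          not-at-u e with κ w ≟ u
          ... | yes e' = n (trans (sym (proj₂ (proj₂ κ-classified) i w d)) e')
          not-at-u () | no _

        collapse-μ : ∀ {i w} → f i ~ w → collapse c (μ w) ≡ i
        collapse-μ {i} {w} d = go (i ≟ u)
          where
          go : Dec (i ≡ u) → collapse c (μ w) ≡ i
          go (yes refl) = trans (cong (collapse c) (μ-inside d)) (t-cluster (τ w))
          go (no n) = cong (collapse c) (μ-outside n d)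

        -- A component has no boundary to stay away from, so one relation serves all depths.
        Z : ℕ → W → X → Set
        Z _ w v = f (collapse c v) ~ w × SameBits v (μ w)

        -- Here the size of the cluster is used: each pattern needs a theory of its own to be
        -- attained. The back conditions follow.
        realize : ∀ v → ∃ λ w → Z 0 w v
        realize v = go v (collapse c v ≟ u)
          where
          go : ∀ v → Dec (InCluster v) → ∃ λ w → Z 0 w v
          go v (yes e) = let j , b = t-cover v e
                             inC = proj₁ (proj₂ y-scattered) j
                             μy = trans (μ-inside inC) (cong t (proj₂ (proj₂ τ-classified) j (y j) (λ _ → (λ h → h) , λ h → h)))
                         in y j , subst (λ i → f i ~ y j) (sym e) inC ,
                            λ i l → trans (sym (b i l)) (cong (U i) (sym μy))
          go (inj₁ i) (no n) = f i , cluster-refl , λ a l → cong (U a) (sym (μ-outside n cluster-refl))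
          go (inj₂ _) (no n) = ⊥-elim (n refl)

        σ : ℕ → Fm
        σ i = proj₁ (μ-definable (U i))

        follow : ∀ {w v w'} → f (collapse c v) ~ w → Adj R w w' → ∃ λ v' → Z 0 w' v'
        follow d a = let i , e = covering _ (component-adj (component-adj (inside _) (inj₁ (proj₁ d))) a)
                     in μ _ , subst (λ j → f j ~ _) (sym (collapse-μ e)) e , λ _ _ → refl

        bisim : Bisim F (blowup c) V U σ k Z
        bisim = record
          { atom = λ {n} {w} {v} (_ , b) i l → subst (λ t → w ⊩ σ i ⟺ (t ≡ true)) (sym (b i l)) (proj₂ (μ-definable (U i)) w)
          ; forth = λ {n} {w} {v} (d , _) s → let v' , z = follow {v = v} d (inj₁ s)
              in v' , proj₂ (relation _ _) (R-trans (proj₁ d) (R-trans s (proj₂ (proj₁ z)))) , z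
          ; forth⁻ = λ {n} {w} {v} (d , _) s → let v' , z = follow {v = v} d (inj₂ s)
              in v' , proj₂ (relation _ _) (R-trans (proj₁ (proj₁ z)) (R-trans s (proj₂ d))) , z
          ; back = λ {n} {w} {v} {v'} (d , _) s → let w' , z = realize v'
              in w' , R-trans (proj₂ d) (R-trans (proj₁ (relation (collapse c v) (collapse c v')) s) (proj₁ (proj₁ z))) , z
          ; back⁻ = λ {n} {w} {v} {v'} (d , _) s → let w' , z = realize v'
              in w' , R-trans (proj₂ (proj₁ z)) (R-trans (proj₁ (relation (collapse c v') (collapse c v)) s) (proj₁ d)) , z }

        blowup-holds : ∀ {a} v → L a → varBound a ≤ k → Holds (blowup c) U v a
        blowup-holds {a} v h l = let w , z = realize v in
          proj₁ (Bisim.invariant bisim a {modalDepth a} ≤-refl l z) (valid (sub σ h) w)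

    ClusterSizeBelow : PointedCode → ℕ → Set
    ClusterSizeBelow c n = Good (just c) → ∀ x (s : Skeleton x (PointedCode.matrix c)) →
      ¬ Scattered _≈_ (Skeleton.f s (PointedCode.point c) ~_) n

    cluster-bound : ∀ c → ∃ (ClusterSizeBelow c)
    cluster-bound c with em (Good (just c))
    ... | inj₂ n = 0 , λ g → ⊥-elim (n g)
    ... | inj₁ g with refutation (notBelow (just c) g)
    -- Only the atoms of the refuted formula have to be imitated, whence the exponent.
    ... | a , h , U , v , ref = 2 ^ varBound a , λ _ x s big →
      ref (ClusterBound.blowup-holds c U (varBound a) s big v h ≤-refl)

    abstract
      clusters-bounded : ∃ λ b → ∀ c → c ∈ pointedCodesUpTo (suc (5 ^ rad)) → ClusterSizeBelow c b
      clusters-bounded = uniform-bound ClusterSizeBelow (λ {c} l h g x s t → h g x s (scattered-mono _≈_ (Skeleton.f s (PointedCode.point c) ~_) l t))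
        cluster-bound (pointedCodesUpTo (suc (5 ^ rad)))

    b = proj₁ clusters-bounded

    cluster-cover : ∀ x → ∃ λ l → length l ≤ b × Covers _≈_ (x ~_) l
    cluster-cover x with scattered-or-transversal _≈_ (x ~_) ≈-sym b
    ... | inj₂ (n , l , t) = let k , e , c = transversal-list t in
      k , ≤-trans (≤-reflexive e) (<⇒≤ l) , c
    ... | inj₁ (g , gP , gE) with skeleton x
    ... | n , l , m , s with Skeleton.covering s x (component-refl x)
    -- Every cluster becomes the distinguished one when its representative is chosen as the point of
    -- the skeleton.
    ... | u , d = ⊥-elim (proj₂ clusters-bounded (pointed u m) (pointedCodesUpTo-complete (pointed u m) (s≤s l))
      (Skeleton.code-isBP s , Skeleton.code-connected s , Skeleton.code-antisym s) x s (g , (λ i → cluster-trans d (gP i)) , gE))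

    component-transversal : ∀ x → ∃ λ n → n ≤ 5 ^ rad * b × Transversal _≈_ (Component x) n
    component-transversal x with ball-cover R-isBP x rad
    ... | l , h , c = let n , k , t = transversal ≈-sym ≈-trans cover in
      n , ≤-trans k (≤-trans (length-concatMap (λ y → proj₁ (proj₂ (cluster-cover y))) l) (*-monoˡ-≤ b h)) , t
      where
      cover : Covers _≈_ (Component x) (concatMap (λ y → proj₁ (cluster-cover y)) l)
      cover = covers-concatMap (λ y → proj₁ (cluster-cover y)) c
        λ w p → w , p , λ y e → proj₂ (proj₂ (cluster-cover y)) w e

    module FiniteComponent {x : W} {n : ℕ} (tr : Transversal _≈_ (Component x) n) where
      g = proj₁ (proj₁ tr)
      inside = proj₁ (proj₂ (proj₁ tr))
      covering = proj₂ tr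

      matrix : Matrix n
      matrix = encode (λ i j → R (g i) (g j))

      G : Frame
      G = toFrame (codeFrame (n , matrix))

      matrix-spec : ∀ i j → Entry matrix i j ⟺ R (g i) (g j)
      matrix-spec = encode-spec (λ i j → R (g i) (g j))

      Z : ℕ → W → Fin n → Set
      Z _ w i = g i ≈ w

      reach : ∀ {i w w'} → g i ≈ w → Adj R w w' → ∃ λ j → g j ≈ w'
      reach {i} e (inj₁ s) = covering _ (component-adj (inside i) (inj₁ (tight λ a h → proj₁ (e (□ a)) h _ s)))
      reach {i} e (inj₂ s) = covering _ (component-adj (inside i) (inj₂ (R-≈ (λ _ → (λ h → h) , λ h → h) (≈-sym e) s)))

      bisim : ∀ (U : Valuation G) σ k → (∀ {w j} → g j ≈ w → ∀ i → w ⊩ σ i ⟺ (U i j ≡ true)) →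
        Bisim F G V U σ k Z
      bisim U σ k h = record
        { atom = λ e i _ → h e i
        ; forth = λ e s → let j , e' = reach e (inj₁ s) in j , proj₂ (matrix-spec _ _) (R-≈ (≈-sym e) (≈-sym e') s) , e'
        ; forth⁻ = λ e s → let j , e' = reach e (inj₂ s) in j , proj₂ (matrix-spec _ _) (R-≈ (≈-sym e') (≈-sym e) s) , e'
        ; back = λ e s → g _ , R-≈ e (λ _ → (λ h → h) , λ h → h) (proj₁ (matrix-spec _ _) s) , λ _ → (λ h → h) , λ h → h
        ; back⁻ = λ e s → g _ , R-≈ (λ _ → (λ h → h) , λ h → h) e (proj₁ (matrix-spec _ _) s) , λ _ → (λ h → h) , λ h → h }

      -- Finitely many distinct theories are separated by formulas, so every valuation of the
      -- quotient comes from a substitution.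
      sound : L ⊆L Log G
      sound a h U j = proj₁ (Bisim.invariant (bisim U σ (varBound a) atom) a {modalDepth a} ≤-refl ≤-refl
                        (λ _ → (λ h → h) , λ h → h)) (valid (sub σ h) (g j))
        where
        abstract
          classified : ∃ λ (τ : W → Fin n) → Definable τ × (∀ i w → g i ≈ w → τ w ≡ i)
          classified = classifier′ j (λ i w → g i ≈ w) λ i j n → ≈-separated (proj₂ (proj₂ (proj₁ tr)) i j n)
        σ : ℕ → Fm
        σ i = proj₁ (proj₁ (proj₂ classified) (U i))
        atom : ∀ {w j} → g j ≈ w → ∀ i → w ⊩ σ i ⟺ (U i j ≡ true)
        atom {w} {j} e i = subst (λ k → w ⊩ σ i ⟺ (U i k ≡ true)) (proj₂ (proj₂ classified) j w e)
          (proj₂ (proj₁ (proj₂ classified) (U i)) w)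

      complete-at : ∀ {a} → Log G a → x ⊩ a
      complete-at {a} h = let j , e = covering x (component-refl x) in
        subst (x ⊩_) (subst'-var a) (proj₂ (Bisim.invariant (bisim U var (varBound a) atom) a {modalDepth a} ≤-refl ≤-refl e) (h U j))
        where
        U : Valuation G
        U i j = truth (g j ⊩ var i)
        atom : ∀ {w j} → g j ≈ w → ∀ i → w ⊩ var i ⟺ (U i j ≡ true)
        atom e i = (λ h → truth⁺ (proj₂ (e (var i)) h)) , λ h → proj₁ (e (var i)) (truth⁻ h)

    -- The finite frame collects all coded frames of bounded size that validate `L`; every component
    -- modulo `≈` is among them.
    tabular : Tabular L
    tabular with union-of-codes (λ c → L ⊆L Log (toFrame (codeFrame c))) (codesUpTo (suc (5 ^ rad * b)))
    ... | U , spec = U ,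
      (λ a h → Log⇒LogF U a (proj₂ (spec a) λ c _ k → k a h)) ,
      λ a h → complete λ x →
        let n , l , tr = component-transversal x
            open FiniteComponent tr
        in complete-at (proj₁ (spec a) (LogF⇒Log U a h) (n , matrix) (codesUpTo-complete matrix (s≤s l)) sound)

  not-below⇒tabular : ∀ {L} → ExtS4BP L → (∀ i → Good i → ¬ (L ⊆L indexLogic i)) → Tabular L
  not-below⇒tabular {L} ext = Tabularity.tabular ext (Canonical.canonicalModel L (proj₁ ext))

  -- Diameter and eccentricity over the fences

  module _ (F : Frame) where
    open Frame F renaming (World to W; Rel to R)

    diameter≤-valid : ∀ {k} → (∀ x y → Reach R k x y) → ∀ K → Log F (diameter≤ K k)
    diameter≤-valid {k} h K V w t far =
      let v , _ , n = proj₁ (within-holds K (¬' (within k p))) far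
      in n (proj₂ (within-holds k p) (w , h v w , t))
      where open Reachability F V

    diameter≤-elim : ∀ {K k x y} → Log F (diameter≤ K k) → Reach R K x y → Reach R k y x
    diameter≤-elim {K} {k} {x} {y} h r = dne λ n →
      h V x (truth⁺ refl) (proj₂ (within-holds K (¬' (within k p))) (y , r , λ t →
        let v , s , e = proj₁ (within-holds k p) t in n (subst (Reach R k y) (truth⁻ e) s)))
      where
      V : Valuation F
      V _ v = truth (v ≡ x)
      open Reachability F V

  module FenceLogic (k : ℕ) where
    private
      -- With `k + 2` points the diameter `k + 1` is positive, hence unchanged by the blow-up, whose
      -- copies of one point are at distance 1.
      c = fence (suc k)
      B = blowup c
      module f = Fence (suc k)

    logic : Logic
    logic = indexLogic (just c)

    diameter≤-fence : ∀ K → logic (diameter≤ K (suc k))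
    diameter≤-fence = diameter≤-valid B (λ v w → blowup-reach c {k} {v} {w} (f.reach (collapse c v) (collapse c w)))

    zigzag : ∀ {v w} → Frame.Rel B v w → Zigzag (toℕ (collapse c v)) (toℕ (collapse c w))
    zigzag {v} {w} = proj₁ (f.spec (collapse c v) (collapse c w))

    private
      alone : ∀ {i v w} → collapse c v ≡ suc i → toℕ (collapse c v) ≡ toℕ (collapse c w) → v ≡ w
      alone {v = inj₁ x} {inj₁ y} e e' = cong inj₁ (toℕ-injective e')
      alone {v = inj₁ .(suc _)} {inj₂ _} refl ()

    splitting⇒root : ∀ V w → Holds B V w splitting → collapse c w ≡ zero
    splitting⇒root V w h = go (collapse c w) refl
      where
      up = ∧-elim (proj₁ (∧-elim h))
      down = ∧-elim (proj₂ (∧-elim h))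
      clash : ∀ {v v'} → v ≡ w → v' ≡ w → V 0 v ≡ true → ¬ V 0 v' ≡ true → ⊥
      clash refl refl t n = n t
      go : ∀ i → collapse c w ≡ i → i ≡ zero
      go zero _ = refl
      go (suc i) e with even (toℕ (collapse c w)) in ev
      -- An even position is minimal, so its past is the point itself; odd positions are dual.
      ... | true = let v , s , t = ◇-elim (proj₁ down) ; v' , s' , n = ◇-elim (proj₂ down)
                   in ⊥-elim (clash (below {v} s) (below {v'} s') t n)
        where
        below : ∀ {v} → Frame.Rel B v w → v ≡ w
        below {v} s with zigzag {v} {w} s
        ... | inj₁ e' = sym (alone {i} {w} {v} e (sym e'))
        ... | inj₂ (ev' , st) = ¬step-step st ev' ev
      ... | false = let v , s , t = ◇-elim (proj₁ up) ; v' , s' , n = ◇-elim (proj₂ up)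
                    in ⊥-elim (clash (above {v} s) (above {v'} s') t n)
        where
        above : ∀ {v} → Frame.Rel B w v → v ≡ w
        above {v} s with zigzag {w} {v} s
        ... | inj₁ e' = sym (alone {i} {w} {v} e e')
        ... | inj₂ (ev' , _) = ⊥-elim (true≢false (trans (sym ev') ev))

    eccentricity>-fence : logic (eccentricity> k)
    eccentricity>-fence V w h = proj₂ (within-holds (suc k) {w} (¬' (within k splitting)))
      -- The far end is `k + 1` steps from the points over 0, where alone `splitting` can hold.
      (inj₁ last , blowup-reach c {k} {w} {inj₁ last} (f.reach (collapse c w) last) , λ t →
        let v , r , s = proj₁ (within-holds k {inj₁ last} splitting) t
        in too-far {v} (splitting⇒root V v s)
             (reach-map {S = Zigzag} (λ v → toℕ (collapse c v)) (λ {x} {y} → zigzag {x} {y}) {k} {inj₁ last} {v} r))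
      where
      open Reachability B V
      last : Fin (suc (suc k))
      last = fromℕ (suc k)
      too-far : ∀ {v} → collapse c v ≡ zero → ¬ Reach Zigzag k (toℕ last) (toℕ (collapse c v))
      too-far {v} e r = <-irrefl refl (≤-trans (≤-reflexive (sym (toℕ-fromℕ (suc k))))
        (≤-trans (reach-zigzag {k} (reach-sym {n = k} (subst (λ i → Reach Zigzag k (toℕ last) (toℕ i)) e r)))
                 (≤-reflexive (+-identityʳ k))))

    above⇒diameter : ∀ i → logic ⊆L indexLogic i → ∀ {K x y} →
      Reach (Frame.Rel (frameOf i)) K x y → Reach (Frame.Rel (frameOf i)) (suc k) y x
    above⇒diameter i s {K} = diameter≤-elim (frameOf i) {K} {suc k} (s (diameter≤ K (suc k)) (diameter≤-fence K))

    ¬zigzag-above : ¬ logic ⊆L indexLogic nothing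
    ¬zigzag-above s = <-irrefl refl
      (reach-zigzag {suc k} (reach-sym {n = suc k} (above⇒diameter nothing s {n} {0} {n + 0} (zigzag-reach n 0))))
      -- The points 0 and `k + 2` are one step farther apart than the diameter allows.
      where n = suc (suc k)

    -- By connectedness the diameter formulas put the whole code into one ball, whose clusters are
    -- single points by antisymmetry.
    finite-above : ∀ i → Good i → logic ⊆L indexLogic i → i ∈ map just (pointedCodesUpTo (suc (5 ^ suc k)))
    finite-above nothing _ s = ⊥-elim (¬zigzag-above s)
    finite-above (just d) (bp , con , anti) s = ∈-map⁺ just (pointedCodesUpTo-complete d (s≤s (≤-trans
      (scattered≤cover (Local.cluster-sym bp) (Local.cluster-trans bp) everything (proj₂ (proj₂ balls))) (proj₁ (proj₂ balls)))))
      where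
      open PointedCode d
      Ball : Fin size → Set
      Ball = Local.Ball bp point (suc k)
      balls : ∃ λ l → length l ≤ 5 ^ suc k × Covers (Cluster (Entry matrix)) Ball l
      balls = ball-cover bp point (suc k)
      reach : ∀ i → Reach (Entry matrix) (suc k) point i
      reach i = reach-map {S = Entry matrix} (collapse d) (λ h → h) {suc k} {inj₁ point} {inj₁ i}
        (above⇒diameter (just d) s {proj₁ (con i point)} (reach-map {R = Entry matrix} inj₁ (λ h → h) (proj₂ (con i point))))
      everything : Scattered (Cluster (Entry matrix)) Ball size
      everything = (λ i → i) ,
        (λ i → subst (λ n → Local.Ball bp point n i) (+-identityʳ (suc k))
          (reach⇒ball bp {point} {0} {suc k} (Local.cluster-refl bp) (reach i))) ,
        λ i j n (r , r') → n (anti r r')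

  -- A copy of the distinguished point splits. The first logic then provides a point more than `k`
  -- steps from it, and the second allows at most `k' + 1` steps.
  fence-parameter-≤ : ∀ {k k'} i → Good i → FenceLogic.logic k ⊆L indexLogic i →
    FenceLogic.logic k' ⊆L indexLogic i → k ≤ k'
  fence-parameter-≤ {k} nothing g s _ = ⊥-elim (FenceLogic.¬zigzag-above k s)
  fence-parameter-≤ {k} {k'} (just d) (bp , con , _) s s' = ≮⇒≥ λ lt →
    let v , r , n = proj₁ (within-holds (suc k) {inj₂ 0} (¬' (within k splitting)))
          (s (eccentricity> k) (FenceLogic.eccentricity>-fence k) V (inj₂ 0) splits)
    in n (proj₂ (within-holds k {v} splitting) (inj₂ 0 ,
         reach-mono {R = Frame.Rel (blowup d)} (λ {x} → R-refl {x}) {suc k'} {k} {v} {inj₂ 0} lt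
           (FenceLogic.above⇒diameter k' (just d) s' {suc k} {inj₂ 0} {v} r) , splits))
    where
    V : Valuation (blowup d)
    V _ v = truth (v ≡ inj₂ 0)
    open Reachability (blowup d) V
    R-refl : ∀ {x} → Frame.Rel (blowup d) x x
    R-refl {x} = IsBP.R-refl bp {collapse d x}
    other : ¬ V 0 (inj₂ 1) ≡ true
    other e with truth⁻ e
    ... | ()
    splits : Holds (blowup d) V (inj₂ 0) splitting
    splits = ∧-intro (∧-intro (◇-intro (inj₂ 0) (R-refl {inj₂ 0}) (truth⁺ refl)) (◇-intro (inj₂ 1) (R-refl {inj₂ 0}) other))
                     (∧-intro (◇-intro (inj₂ 0) (R-refl {inj₂ 0}) (truth⁺ refl)) (◇-intro (inj₂ 1) (R-refl {inj₂ 0}) other))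

  -- Maximal indices

  infix 4 _≼_
  _≼_ : Maybe PointedCode → Maybe PointedCode → Set
  i ≼ j = indexLogic i ⊆L indexLogic j

  Maximal : Maybe PointedCode → Set
  Maximal i = Good i × ∀ j → Good j → i ≼ j → j ≼ i

  Ascent : List (Maybe PointedCode) → Maybe PointedCode → Set
  Ascent l i = ∃ λ j → Good j × i ≼ j × ∀ m → m ∈ l → Good m → j ≼ m → m ≼ j

  -- One pass is enough: a member not above the current index is not above any later, larger choice.
  ascend : ∀ l i → Good i → Ascent l i
  ascend [] i g = i , g , (λ _ h → h) , λ _ ()
  ascend (m ∷ l) i g = step (em (Good m × i ≼ m))
    where
    step : Good m × i ≼ m ⊎ ¬ (Good m × i ≼ m) → Ascent (m ∷ l) i
    step (inj₁ (g' , s)) = let j , gj , t , top = ascend l m g' in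
      j , gj , (λ a h → t a (s a h)) , λ { .m (here refl) _ _ → t ; n (there x) → top n x }
    step (inj₂ none) = let j , gj , t , top = ascend l i g in
      j , gj , t , λ { .m (here refl) g' s → ⊥-elim (none (g' , λ a h → s a (t a h))) ; n (there x) → top n x }

  maximal-above-fence : ∀ k → ∃ λ i → Maximal i × FenceLogic.logic k ⊆L indexLogic i
  maximal-above-fence k with ascend (map just (pointedCodesUpTo (suc (5 ^ suc k)))) (just (fence (suc k))) (Fence.good (suc k))
  ... | j , g , s , top = j ,
    (g , λ m g' t → top m (FenceLogic.finite-above k m g' (λ a h → t a (s a h))) g' t) , s

  -- A proper extension below a member `j` would be squeezed between two logics that maximality
  -- makes equal; so it lies below no member.
  maximal⇒pretabular : ∀ {i} → Maximal i → ExtS4BP (indexLogic i) × Pretabular (indexLogic i)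
  maximal⇒pretabular {i} (g , top) = ext , proj₁ ext , indexLogic-¬tabular i g ,
    λ L' ntl s (φ , h , n) _ → not-below⇒tabular (ExtS4BP-mono ext ntl s)
      λ j g' t → n (top j g' (λ a k → t a (s a k)) φ (t φ h))
    where
    ext : ExtS4BP (indexLogic i)
    ext = Log-extendsS4BP (frameOf i) (frameOf-isBP i g)

  module _ {L : Logic} (ext : ExtS4BP L) (pre : Pretabular L) where
    -- Otherwise the member would be a proper consistent extension of `L`, hence tabular.
    below⇒equal : ∀ i → Good i → L ⊆L indexLogic i → indexLogic i ⊆L L
    below⇒equal i g s φ h = dne λ n → indexLogic-¬tabular i g
      (proj₂ (proj₂ pre) (indexLogic i) (Log-isNTL (frameOf i)) s (φ , h , n) (inhabited i))
      where
      inhabited : ∀ i → ¬ indexLogic i ⊥'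
      inhabited nothing h = h (λ _ _ → true) 0
      inhabited (just _) h = h (λ _ _ → true) (inj₂ 0)

    below-maximal : ∃ λ i → Maximal i × L ⊆L indexLogic i
    below-maximal with em (∃ λ i → Good i × L ⊆L indexLogic i)
    ... | inj₁ (i , g , s) = i , (g , λ j g' t φ h → s φ (below⇒equal j g' (λ a k → t a (s a k)) φ h)) , s
    ... | inj₂ n = ⊥-elim (proj₁ (proj₂ pre) (not-below⇒tabular ext λ i g s → n (i , g , s)))

  -- Enumerating the maximal logics

  least : ∀ (P : ℕ → Set) → ∃ P → ∃ λ m → P m × ∀ k → P k → m ≤ k
  least P (n , h) = [ (λ x → x) , (λ none → ⊥-elim (none n ≤-refl h)) ]′ (search (suc n))
    where
    search : ∀ n → (∃ λ m → P m × ∀ k → P k → m ≤ k) ⊎ (∀ k → k < n → ¬ P k)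
    search zero = inj₂ λ _ ()
    search (suc n) with search n | em (P n)
    ... | inj₁ x | _ = inj₁ x
    ... | inj₂ none | inj₁ h = inj₁ (n , h , λ k x → ≮⇒≥ λ l → none k l x)
    ... | inj₂ none | inj₂ h = inj₂ λ k l → [ none k , (λ { refl → h }) ]′ (m≤n⇒m<n∨m≡n (≤-pred l))

  module Enumerate (S : ℕ → Set) (unbounded : ∀ b → ∃ λ n → b ≤ n × S n) where
    next : ∀ b → ∃ λ n → (b ≤ n × S n) × ∀ k → b ≤ k × S k → n ≤ k
    next b = least (λ n → b ≤ n × S n) (unbounded b)

    f : ℕ → ℕ
    f zero = proj₁ (next 0)
    f (suc n) = proj₁ (next (suc (f n)))

    f-S : ∀ n → S (f n)
    f-S zero = proj₂ (proj₁ (proj₂ (next 0)))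
    f-S (suc n) = proj₂ (proj₁ (proj₂ (next (suc (f n)))))

    f-increasing : ∀ n → f n < f (suc n)
    f-increasing n = proj₁ (proj₁ (proj₂ (next (suc (f n)))))

    f-mono : ∀ {m n} → m < n → f m < f n
    f-mono {m} {suc n} (s≤s l) with m≤n⇒m<n∨m≡n l
    ... | inj₁ l' = ≤-trans (f-mono l') (<⇒≤ (f-increasing n))
    ... | inj₂ refl = f-increasing n

    f-injective : ∀ m n → f m ≡ f n → m ≡ n
    f-injective m n e with <-cmp m n
    ... | tri< l _ _ = ⊥-elim (<-irrefl e (f-mono l))
    ... | tri≈ _ x _ = x
    ... | tri> _ _ l = ⊥-elim (<-irrefl (sym e) (f-mono l))

    n≤f : ∀ n → n ≤ f n
    n≤f zero = z≤n
    n≤f (suc n) = ≤-<-trans (n≤f n) (f-increasing n)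

    f-surjective : ∀ s → S s → ∃ λ n → f n ≡ s
    f-surjective s h = go (suc s) (n≤f (suc s))
      where
      go : ∀ n → s < f n → ∃ λ n → f n ≡ s
      go zero l = ⊥-elim (<-irrefl refl (<-≤-trans l (proj₂ (proj₂ (next 0)) s (z≤n , h))))
      go (suc n) l with <-cmp s (f n)
      ... | tri< l' _ _ = go n l'
      ... | tri≈ _ e _ = n , sym e
      ... | tri> _ _ l' = ⊥-elim (<-irrefl refl (<-≤-trans l (proj₂ (proj₂ (next (suc (f n)))) s (l' , h))))

  -- Between maximal indices `≼` amounts to equality of logics, so this is the first occurrence of a
  -- logic.
  First : ℕ → Set
  First n = Maximal (enumCode n) × ∀ m → m < n → Maximal (enumCode m) → ¬ enumCode n ≼ enumCode m

  first-above : ∀ L → (∃ λ i → Maximal i × L ⊆L indexLogic i) → ∃ λ n → First n × L ⊆L indexLogic (enumCode n)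
  first-above L (i , m , s) with enumCode-surjective i
  ... | n₀ , refl with least (λ n → Maximal (enumCode n) × L ⊆L indexLogic (enumCode n)) (n₀ , m , s)
  ... | n , (max , t) , low = n , (max , λ k l max' u →
    <-irrefl refl (<-≤-trans l (low k (max' , λ a h → u a (t a h))))) , t

  -- If all first indices were below `b`, two of the fences with parameters 0 to `b` would share
  -- one, from which both parameters can be recovered.
  first-unbounded : ∀ b → ∃ λ n → b ≤ n × First n
  first-unbounded b = dne λ none →
    let above = λ k → first-above (FenceLogic.logic k) (maximal-above-fence k)
        small = λ k → ≰⇒> λ l → none (proj₁ (above k) , l , proj₁ (proj₂ (above k)))
        i , j , i<j , e = pigeonhole {b} {suc b} ≤-refl (λ k → fromℕ< (small (toℕ k)))
        same = trans (sym (toℕ-fromℕ< (small (toℕ i)))) (trans (cong toℕ e) (toℕ-fromℕ< (small (toℕ j))))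
        n , fst , s = above (toℕ i)
        s' = subst (λ m → FenceLogic.logic (toℕ j) ⊆L indexLogic (enumCode m)) (sym same) (proj₂ (proj₂ (above (toℕ j))))
    in <-irrefl refl (<-≤-trans i<j (fence-parameter-≤ (enumCode n) (proj₁ (proj₁ fst)) s' s))

  open Enumerate First first-unbounded

  pretabular-logic : ℕ → Logic
  pretabular-logic n = indexLogic (enumCode (f n))

  first-above-≥ : ∀ {m n} → First m → First n → enumCode n ≼ enumCode m → n ≤ m
  first-above-≥ {m} fm fn s = ≮⇒≥ λ l → proj₂ fn m l (proj₁ fm) s

  pretabular-logic-injective : ∀ m n → pretabular-logic m ≐ pretabular-logic n → m ≡ n
  pretabular-logic-injective m n (s , t) = f-injective m n
    (≤-antisym (first-above-≥ (f-S n) (f-S m) s) (first-above-≥ (f-S m) (f-S n) t))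

  pretabular-logic-surjective : ∀ L → ExtS4BP L → Pretabular L → ∃ λ n → L ≐ pretabular-logic n
  pretabular-logic-surjective L ext pre =
    let n , fst , s = first-above L (below-maximal ext pre)
        k , e = f-surjective n fst
    in k , subst (λ m → L ≐ indexLogic (enumCode m)) (sym e)
             (s , below⇒equal ext pre (enumCode n) (proj₁ (proj₁ fst)) s)

theorem7p13 : ExcludedMiddle → CountablyInfinitePTAB
theorem7p13 em = pretabular-logic ,
  (λ n → maximal⇒pretabular (proj₁ (Enumerate.f-S First first-unbounded n))) ,
  pretabular-logic-injective , pretabular-logic-surjective
  where open Classical em
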